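{- Let $L$ be a regular language. Then, for every $\epsilon > 0$, the dynamic problem $\mathrm{RangeMember}(L)$ can be maintained in $\mathsf{DynFO}$ with work $\mathcal{O}(n^{\epsilon})$ per query and change operation.
   Context: RangeMember. For a fixed language $L$ over a finite alphabet $\Sigma$, $\mathrm{RangeMember}(L)$ is the following dynamic problem. Input: a sequence $w=w_0\ldots w_{n-1}$ with $w_i\in\Sigma\cup\{\epsilon\}$ (here $\epsilon$ is the empty word), encoded as a structure with domain $[n]$, its linear order, and one unary relation $R_\sigma=\{i: w_i=\sigma\}$ for each $\sigma\in\Sigma$; initially all $w_i=\epsilon$. Change operations: $\mathrm{set}_\sigma(i)$ for $\sigma\in\Sigma$ (sets $w_i$ to $\sigma$ if $w_i=\epsilon$) and $\mathrm{reset}(i)$ (sets $w_i$ to $\epsilon$). Query operation: $\mathrm{range}(\ell,r)$: is $w_\ell\circ\cdots\circ w_r\in L$? Conventions. Structures have a finite domain $D=[n]=\{0,\dots,n-1\}$ and a finite schema of relation and function symbols; functions may be partial (undefined value $\bot$). The natural linear order $\le$ and compatible $+$ and $\times$ are always available to formulas, terms and conditions. First-order terms may use if-then-else: $\mathrm{ITE}(\varphi,t_1,t_2)$ evaluates to $t_1$ if $\varphi$ holds and to $t_2$ otherwise. Dynamic problems. A dynamic problem $\Pi$ is given by a schema of input structures and a finite set of operations: change operations, which modify the input structure, and query operations, which return a truth value (relational queries) or elements (functional queries) depending on their parameters. Unless stated otherwise the initial input structure is empty. $\mathsf{DynFO}$. A dynamic program for $\Pi$ stores an auxiliary structure $\mathcal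 A$ over a schema $\tau_{aux}$ on the domain of the input; initially $\mathcal A$ is first-order definable from the initial input. For each query operation $Q(\bar p)$ it has one query rule giving the result by a first-order formula (or term) evaluated on $\mathcal A$. For each change operation $\delta(\bar p)$ and each auxiliary relation $R$ it has one update rule "on change $\delta(\bar p)$ update $R$ at $(t_1(\bar p;\bar x),\dots,t_k(\bar p;\bar x))$ as $\varphi(\bar p;\bar x)$ where $C(\bar x)$", with terms $t_i$, a first-order formula $\varphi$ and a conjunction $C$ of inequalities $x_i\le g_i(n)$ with first-order definable $g_i:\mathbb N\to\mathbb N$. After $\delta(\bar a)$, the new $R$ arises from the old one by removing all tuples $(t_1(\bar a;\bar b),\dots,t_k(\bar a;\bar b))$ with $\bar b$ satisfying $C$ and adding those for which $\mathcal A\models\varphi(\bar a;\bar b)$ (old $\mathcal A$). For auxiliary functions, a term gives the new value instead. The program must answer all queries correctly after every sequence of changes. Procedural-DynFO. Here the formula or term of an update rule is replaced by an update procedure $P=P_1;P_2$. The program may declare supplementary instances of other dynamic problems, each with its own program. The initial procedure $P_1$ does not use $\bar x$, is executed once per change and may, outside parallel branches, invoke change operations $\mathrm{instance}.\delta(\bar y)$ of supplementary instances (for each main change operation and each supplementary instance, in at most one update rule). The main procedure $P_2$ is executed for every $\bar x$ satisfying $C$, may use $\bar x$, and may use "return condition/term" outside parallel branches. Both consist of: assignments $f(\bar y)\leftarrow$ term and $R(\bar y)\leftarrow$ condition (symbols not in $\tau_{aux}$; inside a parallel branch binding $z$, $z$ occurs in $\bar y$); "if condition then $P'$ else $P''$";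 "for $z\le g(n)$ pardo $P'$". Terms are built from local variables, variables of $\bar p,\bar x$, function symbols of $\tau_{aux}$ and previously assigned ones, if-then-else terms, functional queries $\mathrm{instance}.Q(\bar y)$, and $\mathrm{getUnique}(z\le g(n)\mid\text{condition})$ (exactly one such $z$ must exist). Conditions are built from atomic formulas over $\tau_{aux}$ and previously assigned symbols, $\mathrm{exists}(z\le g(n)\mid\text{condition})$, relational queries $\mathrm{instance}.Q(\bar y)$, and Boolean combinations. All $g$ are first-order definable, $n$ is the domain size of the main instance, and every execution path ends with a return of appropriate type. The returned value plays the role of the value of $\varphi$ (or of the term). Query procedures are analogous, with free variables $\bar p$ only and no change invocations. Work. The function $w$ is defined inductively: constants and variables have $w=1$; function applications, atomic conditions, Boolean combinations, if-then-else terms, conditional branches and sequences have the maximum of 1 and the $w$ of their parts; assignments and returns have the $w$ of their right-hand side or argument; getUnique, exists and pardo with bound $z\le g(n)$ have $g(n)$ times the $w$ of their body; a query or change invocation on a supplementary instance has the maximum of $w$ of the respective query rule or update rules and of its argument terms. For an update rule $\pi$ with constraint $x_1\le g_1(n)\wedge\dots\wedge x_\ell\le g_\ell(n)$, $w(\pi)=\max(w(P_1),\,g_1(n)\cdots g_\ell(n)\cdot \max(w(P_2),w(t_1),\dots,w(t_k)))$; for a query rule it is the $w$ of its procedure. A dynamic problem can be maintained in $\mathsf{DynFO}$ with work $\mathcal O(f(n))$ (has a $\mathsf{DynFO}$-program with that work) if it has a Procedural-DynFO program all of whose update and query rules $\pi$ satisfy $w(\pi)\in\mathcal O(f(n))$;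 bounds "per change operation" and "per query operation" refer to update and query rules, respectively. The initialization is not counted. -}

module Defs where

open import Data.Bool using (Bool; true; false; not; _∧_; _∨_; if_then_else_; T)
open import Data.Empty using (⊥)
open import Data.Fin using (Fin; zero; suc; toℕ; fromℕ<; _≟_)
open import Data.List using (List; []; _∷_; allFin; filter; filterᵇ; head; mapMaybe; cartesianProductWith; foldl)
open import Data.List.Membership.Propositional using (_∈_)
open import Data.List.Relation.Unary.All using (All)
import Data.List as List
open import Data.Bool.ListAction using (or; any; all)
open import Data.Maybe using (Maybe; just; nothing; is-just; maybe′)
import Data.Maybe.Properties as Maybe
open import Data.Nat using (ℕ; zero; suc; _+_; _*_; _^_; _⊔_; _≤_; _≤?_; _<?_; _≤ᵇ_)
open import Data.Product using (Σ; Σ-syntax; ∃; ∃-syntax; _×_; _,_; proj₁; proj₂)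
open import Data.Rational using (ℚ; ↥_; ↧ₙ_)
open import Data.Integer using (∣_∣)
open import Data.Sum using (_⊎_)
open import Data.Unit using (⊤)
open import Data.Vec using (Vec; []; _∷_; _++_; lookup)
import Data.Vec.Properties as Vec
open import Function using (_⇔_)
open import Relation.Binary.PropositionalEquality using (_≡_; refl)
open import Relation.Nullary using (yes; no; does)
open import Relation.Nullary.Decidable using (_×-dec_)

data Kind : Set where
  relation function : Kind

-- nothing is the undefined value ⊥ of a partial function.
Value : Kind → ℕ → Set
Value relation n = Bool
Value function n = Maybe (Fin n)

undefined : ∀ {n} k → Value k n
undefined relation = false
undefined function = nothing

Tuple : ℕ → ℕ → Set
Tuple n a = Vec (Fin n) a

record Schema : Set where
  field
    size  : Kind → ℕ
    arity : (k : Kind) → Fin (size k) → ℕ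

  Symbol : Kind → Set
  Symbol k = Fin (size k)

open Schema public

∅ : Schema
∅ = record { size = λ _ → 0 ; arity = λ _ () }

Structure : Schema → ℕ → Set
Structure τ n = ∀ k (s : Symbol τ k) → Tuple n (arity τ k s) → Value k n

emptyStructure : ∀ {τ n} → Structure τ n
emptyStructure k _ _ = undefined k

element : ∀ n → ℕ → Maybe (Fin n)
element n m with m <? n
... | yes m<n = just (fromℕ< m<n)
... | no  _   = nothing

lift₂ : ∀ {n k} → (Fin n → Fin n → Value k n) →
        Maybe (Fin n) → Maybe (Fin n) → Value k n
lift₂ f (just x) (just y) = f x y
lift₂ {k = k} f _ _       = undefined k

-- Applying a symbol to a tuple with an undefined component yields ⊥,
-- respectively falsity.
apply : ∀ {n a k} → (Tuple n a → Value k n) → Maybe (Tuple n a) → Value k n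
apply f (just t)        = f t
apply {k = k} f nothing = undefined k

consMaybe : ∀ {n a} → Maybe (Fin n) → Maybe (Tuple n a) → Maybe (Tuple n (suc a))
consMaybe (just x) (just t) = just (x ∷ t)
consMaybe _        _        = nothing

addition multiplication : ∀ {n} → Fin n → Fin n → Maybe (Fin n)
addition       {n} x y = element n (toℕ x + toℕ y)
multiplication {n} x y = element n (toℕ x * toℕ y)

equal atMost : ∀ {n} → Fin n → Fin n → Bool
equal  x y = does (x ≟ y)
atMost x y = toℕ x ≤ᵇ toℕ y

singleton : ∀ {A : Set} → List A → Maybe A
singleton (x ∷ []) = just x
singleton _        = nothing

-- First-order logic with built-in ≤, and + and × as partial functions.
-- FO τ v relation are the formulas and FO τ v function the terms over τ
-- with v free variables.  Variables are de Bruijn indices.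

data FO (τ : Schema) (v : ℕ) : Kind → Set where
  var           : Fin v → FO τ v function
  sym           : ∀ {k} (s : Symbol τ k) → Vec (FO τ v function) (arity τ k s) → FO τ v k
  _⊕_ _⊗_       : FO τ v function → FO τ v function → FO τ v function
  ite           : FO τ v relation → FO τ v function → FO τ v function → FO τ v function
  _≐_ _≼_       : FO τ v function → FO τ v function → FO τ v relation
  neg           : FO τ v relation → FO τ v relation
  _and_ _or_    : FO τ v relation → FO τ v relation → FO τ v relation
  exists forAll : FO τ (suc v) relation → FO τ v relation

module _ {τ : Schema} {n : ℕ} (𝒜 : Structure τ n) where

  mutual
    evalFO : ∀ {v k} → FO τ v k → Tuple n v → Value k n
    evalFO (var x)           e = just (lookup e x)
    evalFO (sym {k} s ts)    e = apply {k = k} (𝒜 k s) (evalsFO ts e)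
    evalFO (t ⊕ u)           e = lift₂ addition (evalFO t e) (evalFO u e)
    evalFO (t ⊗ u)           e = lift₂ multiplication (evalFO t e) (evalFO u e)
    evalFO (ite φ t u)       e = if evalFO φ e then evalFO t e else evalFO u e
    evalFO (t ≐ u)           e = lift₂ equal (evalFO t e) (evalFO u e)
    evalFO (t ≼ u)           e = lift₂ atMost (evalFO t e) (evalFO u e)
    evalFO (neg φ)           e = not (evalFO φ e)
    evalFO (φ and ψ)         e = evalFO φ e ∧ evalFO ψ e
    evalFO (φ or ψ)          e = evalFO φ e ∨ evalFO ψ e
    evalFO (exists φ)        e = any (λ x → evalFO φ (x ∷ e)) (allFin n)
    evalFO (forAll φ)        e = all (λ x → evalFO φ (x ∷ e)) (allFin n)

    evalsFO : ∀ {v a} → Vec (FO τ v function) a → Tuple n v → Maybe (Tuple n a)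
    evalsFO []       e = just []
    evalsFO (t ∷ ts) e = consMaybe (evalFO t e) (evalsFO ts e)

-- First-order definitions of relations (by their elements) and of partial
-- functions (by their graph, the value being variable 0).
Definition : Schema → Kind → ℕ → Set
Definition τ relation a = FO τ a relation
Definition τ function a = FO τ (suc a) relation

extension : ∀ {τ n a} → Structure τ n → ∀ k → Definition τ k a → Tuple n a → Value k n
extension     𝒜 relation φ y = evalFO 𝒜 φ y
extension {n = n} 𝒜 function φ y = singleton (filterᵇ (λ x → evalFO 𝒜 φ (x ∷ y)) (allFin n))

-- First-order definable g : ℕ → ℕ.  The formula must define the element
-- g n of [n]; where g n ≥ n it defines nothing and z ≤ g n excludes no z.
record Bound : Set where
  field
    value   : ℕ → ℕ
    formula : FO ∅ 1 relation
    defines : ∀ n (x : Fin n) →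
              T (evalFO (emptyStructure {∅}) formula (x ∷ [])) ⇔ toℕ x ≡ value n

open Bound public

below : ∀ n → Bound → List (Fin n)
below n g = filter (λ z → toℕ z ≤? value g n) (allFin n)

boundedTuples : ∀ n {ℓ} → Vec Bound ℓ → List (Tuple n ℓ)
boundedTuples n []       = [] ∷ []
boundedTuples n (g ∷ gs) = cartesianProductWith _∷_ (below n g) (boundedTuples n gs)

-- The schema queries gives the relational and functional query operations;
-- an arity is a number of parameters.
record Problem : Set₁ where
  field
    input        : Schema
    changes      : ℕ
    changeArity  : Fin changes → ℕ
    queries      : Schema
    initial      : ∀ n → Structure input n
    perform      : ∀ {n} (δ : Fin changes) → Tuple n (changeArity δ) →
                   Structure input n → Structure input n
    holds        : ∀ {n} → Structure input n → (q : Symbol queries relation) →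
                   Tuple n (arity queries relation q) → Set
    returns      : ∀ {n} → Structure input n → (q : Symbol queries function) →
                   Tuple n (arity queries function q) → Maybe (Fin n)

  Change : Set
  Change = Fin changes

  Answers : ∀ {n} → Structure input n → ∀ k (q : Symbol queries k) →
            Tuple n (arity queries k q) → Value k n → Set
  Answers w relation q a b = T b ⇔ holds w q a
  Answers w function q a x = x ≡ returns w q a

open Problem public

Operation : Problem → ℕ → Set
Operation Π n = Σ[ δ ∈ Change Π ] Tuple n (changeArity Π δ)

inputAfter : (Π : Problem) (n : ℕ) → List (Operation Π n) → Structure (input Π) n
inputAfter Π n = foldl (λ { w (δ , a) → perform Π δ a w }) (initial Π n)

-- Supplementary instances have the same domain as the main instance.
record Vocabulary : Set₁ where
  field
    auxSchema : Schema
    instances : ℕ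
    problem   : Fin instances → Problem

open Vocabulary public

-- Terms (function) and conditions (relation); loc are the symbols that
-- procedures assign, which are disjoint from auxSchema V by construction.
data Exp (V : Vocabulary) (loc : Schema) (v : ℕ) : Kind → Set where
  var        : Fin v → Exp V loc v function
  aux        : ∀ {k} (s : Symbol (auxSchema V) k) →
               Vec (Exp V loc v function) (arity (auxSchema V) k s) → Exp V loc v k
  local      : ∀ {k} (s : Symbol loc k) →
               Vec (Exp V loc v function) (arity loc k s) → Exp V loc v k
  query      : ∀ {k} (i : Fin (instances V)) (q : Symbol (queries (problem V i)) k) →
               Vec (Exp V loc v function) (arity (queries (problem V i)) k q) → Exp V loc v k
  _⊕_ _⊗_    : Exp V loc v function → Exp V loc v function → Exp V loc v function
  ite        : Exp V loc v relation → Exp V loc v function → Exp V loc v function →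
               Exp V loc v function
  getUnique  : Bound → Exp V loc (suc v) relation → Exp V loc v function
  _≐_ _≼_    : Exp V loc v function → Exp V loc v function → Exp V loc v relation
  bool       : Bool → Exp V loc v relation
  neg        : Exp V loc v relation → Exp V loc v relation
  _and_ _or_ : Exp V loc v relation → Exp V loc v relation → Exp V loc v relation
  exists     : Bound → Exp V loc (suc v) relation → Exp V loc v relation

-- A parallel loop records, for each local symbol assigned in its branches,
-- the argument position at which the loop variable occurs.  Thus different
-- branches of a loop never write to the same location.  Branch lists the
-- variables of the enclosing loops together with these records.
Positions : Schema → Set
Positions loc = ∀ k (s : Symbol loc k) → Maybe (Fin (arity loc k s))

Branch : Schema → ℕ → Set
Branch loc v = List (Fin v × Positions loc)

enter : ∀ {loc v} → Positions loc → Branch loc v → Branch loc (suc v)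
enter pos zs = (zero , pos) ∷ List.map (λ { (z , p) → suc z , p }) zs

Owned : ∀ {loc v} → Branch loc v → ∀ k (s : Symbol loc k) → Vec (Fin v) (arity loc k s) → Set
Owned zs k s ys = All (λ { (z , pos) → ∃[ p ] (pos k s ≡ just p × lookup ys p ≡ z) }) zs

-- Change operations of supplementary instances can be invoked in mode
-- invoking only, and parallel branches are always in mode ordinary.
data Mode : Set where
  invoking ordinary : Mode

data Proc (V : Vocabulary) (loc : Schema) : Mode → (v : ℕ) → Branch loc v → Set where
  skip   : ∀ {m v zs} → Proc V loc m v zs
  assign : ∀ {m v zs k} (s : Symbol loc k) (ys : Vec (Fin v) (arity loc k s)) →
           Owned zs k s ys → Exp V loc v k → Proc V loc m v zs
  _⨾_    : ∀ {m v zs} → Proc V loc m v zs → Proc V loc m v zs → Proc V loc m v zs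
  cond   : ∀ {m v zs} → Exp V loc v relation →
           Proc V loc m v zs → Proc V loc m v zs → Proc V loc m v zs
  pardo  : ∀ {m v zs} → Bound → (pos : Positions loc) →
           Proc V loc ordinary (suc v) (enter pos zs) → Proc V loc m v zs
  invoke : ∀ {v zs} (i : Fin (instances V)) (δ : Change (problem V i)) →
           Vec (Exp V loc v function) (changeArity (problem V i) δ) → Proc V loc invoking v zs

-- Main and query procedures: every execution path ends with a return.  (A
-- return in one branch of a conditional leaves what follows the conditional
-- to the other branch.)
data Main (V : Vocabulary) (loc : Schema) (v : ℕ) (k : Kind) : Set where
  return : Exp V loc v k → Main V loc v k
  _⨾_    : Proc V loc ordinary v [] → Main V loc v k → Main V loc v k
  cond   : Exp V loc v relation → Main V loc v k → Main V loc v k → Main V loc v k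

-- A rule "on change δ(p̄) update s at (targets) by P₁;P₂ where x̄ ≤ bounds", for a
-- symbol s of the given kind and arity and a change with a parameters.  The
-- variables of targets and P₂ are p̄ followed by x̄.  Targets are evaluated
-- before P₁, so they use no local symbols.
record UpdateRule (V : Vocabulary) (a : ℕ) (k : Kind) (ar : ℕ) : Set where
  field
    locals  : Schema
    ℓ       : ℕ
    bounds  : Vec Bound ℓ
    targets : Vec (Exp V ∅ (a + ℓ) function) ar
    P₁      : Proc V locals invoking a []
    P₂      : Main V locals (a + ℓ) k

open UpdateRule public

record QueryRule (V : Vocabulary) (a : ℕ) (k : Kind) : Set where
  field
    locals    : Schema
    procedure : Main V locals a k

Invokes : ∀ {V loc m v zs} → Fin (instances V) → Proc V loc m v zs → Set
Invokes i skip             = ⊥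
Invokes i (assign _ _ _ _) = ⊥
Invokes i (P ⨾ Q)          = Invokes i P ⊎ Invokes i Q
Invokes i (cond _ P Q)     = Invokes i P ⊎ Invokes i Q
Invokes i (pardo _ _ _)    = ⊥
Invokes i (invoke j _ _)   = i ≡ j

record Rules (Π : Problem) (V : Vocabulary) : Set where
  field
    initially : ∀ k (s : Symbol (auxSchema V) k) → Definition (input Π) k (arity (auxSchema V) k s)
    onChange  : ∀ (δ : Change Π) k (s : Symbol (auxSchema V) k) →
                UpdateRule V (changeArity Π δ) k (arity (auxSchema V) k s)
    onQuery   : ∀ k (q : Symbol (queries Π) k) → QueryRule V (arity (queries Π) k q) k
    -- For each change, the only update rule that may change the instance.
    invoker   : Change Π → Fin (instances V) → Maybe (Σ Kind (Symbol (auxSchema V)))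
    exclusive : ∀ δ k s i → Invokes i (P₁ (onChange δ k s)) → invoker δ i ≡ just (k , s)

open Rules public

data Program : Problem → Set₁ where
  program : ∀ {Π} (V : Vocabulary) (supplementary : ∀ i → Program (problem V i)) →
            Rules Π V → Program Π

record Machine (Π : Problem) (n : ℕ) : Set₁ where
  field
    State  : Set
    start  : State
    change : (δ : Change Π) → Tuple n (changeArity Π δ) → State → State
    answer : State → ∀ k (q : Symbol (queries Π) k) → Tuple n (arity (queries Π) k q) → Value k n

open Machine public

module Semantics {V : Vocabulary} {n : ℕ} (M : ∀ i → Machine (problem V i) n)
                 (𝒜 : Structure (auxSchema V) n) where

  Instances : Set
  Instances = ∀ i → State (M i)

  module _ {loc : Schema} (L : Structure loc n) (σ : Instances) where

    mutual
      eval : ∀ {v k} → Exp V loc v k → Tuple n v → Value k n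
      eval (var x)            e = just (lookup e x)
      eval (aux {k} s ts)     e = apply {k = k} (𝒜 k s) (evals ts e)
      eval (local {k} s ts)   e = apply {k = k} (L k s) (evals ts e)
      eval (query {k} i q ts) e = apply {k = k} (answer (M i) (σ i) k q) (evals ts e)
      eval (t ⊕ u)            e = lift₂ addition (eval t e) (eval u e)
      eval (t ⊗ u)            e = lift₂ multiplication (eval t e) (eval u e)
      eval (ite c t u)        e = if eval c e then eval t e else eval u e
      eval (getUnique g c)    e = singleton (filterᵇ (λ z → eval c (z ∷ e)) (below n g))
      eval (t ≐ u)            e = lift₂ equal (eval t e) (eval u e)
      eval (t ≼ u)            e = lift₂ atMost (eval t e) (eval u e)
      eval (bool b)           e = b
      eval (neg c)            e = not (eval c e)
      eval (c and d)          e = eval c e ∧ eval d e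
      eval (c or d)           e = eval c e ∨ eval d e
      eval (exists g c)       e = any (λ z → eval c (z ∷ e)) (below n g)

      evals : ∀ {v a} → Vec (Exp V loc v function) a → Tuple n v → Maybe (Tuple n a)
      evals []       e = just []
      evals (t ∷ ts) e = consMaybe (eval t e) (evals ts e)

    -- The proviso on getUnique: exactly one z satisfies the condition
    -- whenever the term is evaluated.
    mutual
      Legal : ∀ {v k} → Exp V loc v k → Tuple n v → Set
      Legal (var _)         e = ⊤
      Legal (aux _ ts)      e = Legals ts e
      Legal (local _ ts)    e = Legals ts e
      Legal (query _ _ ts)  e = Legals ts e
      Legal (t ⊕ u)         e = Legal t e × Legal u e
      Legal (t ⊗ u)         e = Legal t e × Legal u e
      Legal (ite c t u)     e = Legal c e × (if eval c e then Legal t e else Legal u e)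
      Legal (getUnique g c) e = (∀ z → z ∈ below n g → Legal c (z ∷ e)) ×
                                T (is-just (eval (getUnique g c) e))
      Legal (t ≐ u)         e = Legal t e × Legal u e
      Legal (t ≼ u)         e = Legal t e × Legal u e
      Legal (bool _)        e = ⊤
      Legal (neg c)         e = Legal c e
      Legal (c and d)       e = Legal c e × Legal d e
      Legal (c or d)        e = Legal c e × Legal d e
      Legal (exists g c)    e = ∀ z → z ∈ below n g → Legal c (z ∷ e)

      Legals : ∀ {v a} → Vec (Exp V loc v function) a → Tuple n v → Set
      Legals []       e = ⊤
      Legals (t ∷ ts) e = Legal t e × Legals ts e

  write : ∀ {loc} → ∀ k (s : Symbol loc k) → Tuple n (arity loc k s) → Value k n →
          Structure loc n → Structure loc n
  write {loc} relation s y b L relation s′ y′ with s ≟ s′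
  ... | yes refl = if does (Vec.≡-dec _≟_ y y′) then b else L relation s y′
  ... | no  _    = L relation s′ y′
  write {loc} function s y b L function s′ y′ with s ≟ s′
  ... | yes refl = if does (Vec.≡-dec _≟_ y y′) then b else L function s y′
  ... | no  _    = L function s′ y′
  write relation s y b L function s′ y′ = L function s′ y′
  write function s y b L relation s′ y′ = L relation s′ y′

  tell : ∀ i (δ : Change (problem V i)) → Maybe (Tuple n (changeArity (problem V i) δ)) →
         Instances → Instances
  tell i δ nothing  σ j = σ j
  tell i δ (just a) σ j with i ≟ j
  ... | yes refl = change (M i) δ a (σ i)
  ... | no  _    = σ j

  -- A location of a local symbol after a parallel loop.  All branches start
  -- from the same L, and a location can only have been changed by the branch
  -- of the element at the recorded position.
  merge : ∀ {loc} → Bound → Positions loc → (Fin n → Structure loc n) →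
          Structure loc n → Structure loc n
  merge g pos branch L k s y with pos k s
  ... | nothing = L k s y
  ... | just p  with toℕ (lookup y p) ≤? value g n
  ...   | yes _ = branch (lookup y p) k s y
  ...   | no  _ = L k s y

  module _ {loc : Schema} where

    exec : ∀ {m v zs} → Proc V loc m v zs → Tuple n v →
           Structure loc n × Instances → Structure loc n × Instances
    exec skip              e (L , σ) = L , σ
    exec (assign {k = k} s ys _ t) e (L , σ) =
      write k s (Data.Vec.map (lookup e) ys) (eval L σ t e) L , σ
    exec (P ⨾ Q)           e (L , σ) = exec Q e (exec P e (L , σ))
    exec (cond c P Q)      e (L , σ) = if eval L σ c e then exec P e (L , σ) else exec Q e (L , σ)
    exec (pardo g pos P)   e (L , σ) =
      merge g pos (λ z → proj₁ (exec P (z ∷ e) (L , σ))) L , σ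
    exec (invoke i δ ts)   e (L , σ) = L , tell i δ (evals L σ ts e) σ

    LegalProc : ∀ {m v zs} → Proc V loc m v zs → Tuple n v → Structure loc n × Instances → Set
    LegalProc skip             e (L , σ) = ⊤
    LegalProc (assign _ _ _ t) e (L , σ) = Legal L σ t e
    LegalProc (P ⨾ Q)          e (L , σ) =
      LegalProc P e (L , σ) × LegalProc Q e (exec P e (L , σ))
    LegalProc (cond c P Q)     e (L , σ) =
      Legal L σ c e × (if eval L σ c e then LegalProc P e (L , σ) else LegalProc Q e (L , σ))
    LegalProc (pardo g _ P)    e (L , σ) = ∀ z → z ∈ below n g → LegalProc P (z ∷ e) (L , σ)
    LegalProc (invoke _ _ ts)  e (L , σ) = Legals L σ ts e

    result : ∀ {v k} → Main V loc v k → Tuple n v → Structure loc n × Instances → Value k n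
    result (return t)   e (L , σ) = eval L σ t e
    result (P ⨾ Q)      e (L , σ) = result Q e (exec P e (L , σ))
    result (cond c P Q) e (L , σ) = if eval L σ c e then result P e (L , σ) else result Q e (L , σ)

    LegalMain : ∀ {v k} → Main V loc v k → Tuple n v → Structure loc n × Instances → Set
    LegalMain (return t)   e (L , σ) = Legal L σ t e
    LegalMain (P ⨾ Q)      e (L , σ) = LegalProc P e (L , σ) × LegalMain Q e (exec P e (L , σ))
    LegalMain (cond c P Q) e (L , σ) =
      Legal L σ c e × (if eval L σ c e then LegalMain P e (L , σ) else LegalMain Q e (L , σ))

  -- The new value at a location, given the old one and the values returned
  -- for the x̄ whose target is this location.
  combine : ∀ k → Value k n → List (Value k n) → Value k n
  combine relation old []       = old
  combine relation old (b ∷ bs) = or (b ∷ bs)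
  combine function old []       = old
  combine function old (x ∷ _)  = x

  -- Every rule starts from the old auxiliary structure and the old instances;
  -- P₂ sees the instances as changed by the P₁ of its own rule.
  module Update {a k ar} (π : UpdateRule V a k ar) (p : Tuple n a) (σ : Instances) where

    afterP₁ : Structure (locals π) n × Instances
    afterP₁ = exec (P₁ π) p (emptyStructure , σ)

    target : Tuple n (ℓ π) → Maybe (Tuple n ar)
    target x = evals emptyStructure σ (targets π) (p ++ x)

    returned : Tuple n (ℓ π) → Value k n
    returned x = result (P₂ π) (p ++ x) afterP₁

    hits : Tuple n ar → Tuple n (ℓ π) → Bool
    hits y x = does (Maybe.≡-dec (Vec.≡-dec _≟_) (target x) (just y))

    updated : (Tuple n ar → Value k n) → Tuple n ar → Value k n
    updated old y =
      combine k (old y) (List.map returned (filterᵇ (hits y) (boundedTuples n (bounds π))))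

    Consistent : Kind → Set
    Consistent relation = ⊤
    Consistent function = ∀ x x′ y → x ∈ boundedTuples n (bounds π) → x′ ∈ boundedTuples n (bounds π) →
                          target x ≡ just y → target x′ ≡ just y → returned x ≡ returned x′

    LegalUpdate : Set
    LegalUpdate =
      LegalProc (P₁ π) p (emptyStructure , σ) ×
      (∀ x → x ∈ boundedTuples n (bounds π) →
         Legals emptyStructure σ (targets π) (p ++ x) × LegalMain (P₂ π) (p ++ x) afterP₁) ×
      Consistent k

  module Query {a k} (π : QueryRule V a k) (p : Tuple n a) (σ : Instances) where

    response : Value k n
    response = result (QueryRule.procedure π) p (emptyStructure , σ)

    LegalQuery : Set
    LegalQuery = LegalMain (QueryRule.procedure π) p (emptyStructure , σ)

module _ {Π : Problem} {V : Vocabulary} (R : Rules Π V) {n : ℕ}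
         (M : ∀ i → Machine (problem V i) n) where

  newAux : (δ : Change Π) → Tuple n (changeArity Π δ) →
           Structure (auxSchema V) n × (∀ i → State (M i)) → Structure (auxSchema V) n
  newAux δ p (𝒜 , σ) k s = Semantics.Update.updated M 𝒜 (onChange R δ k s) p σ (𝒜 k s)

  newInstances : (δ : Change Π) → Tuple n (changeArity Π δ) →
                 Structure (auxSchema V) n × (∀ i → State (M i)) → ∀ i → State (M i)
  newInstances δ p (𝒜 , σ) i with invoker R δ i
  ... | nothing      = σ i
  ... | just (k , s) = proj₂ (Semantics.Update.afterP₁ M 𝒜 (onChange R δ k s) p σ) i

  machine : Machine Π n
  machine = record
    { State  = Structure (auxSchema V) n × (∀ i → State (M i))
    ; start  = (λ k s → extension (initial Π n) k (initially R k s)) , (λ i → start (M i))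
    ; change = λ δ p st → newAux δ p st , newInstances δ p st
    ; answer = λ { (𝒜 , σ) k q p → Semantics.Query.response M 𝒜 (onQuery R k q) p σ }
    }

interpret : ∀ {Π} → Program Π → ∀ n → Machine Π n
interpret (program V supplementary R) n = machine R (λ i → interpret (supplementary i) n)

stateAfter : ∀ {Π n} (M : Machine Π n) → List (Operation Π n) → State M
stateAfter M = foldl (λ { st (δ , a) → change M δ a st }) (start M)

-- In every reachable state all rules are well-behaved and all queries are
-- answered correctly; the same is required of the supplementary programs.
Correct : ∀ {Π} → Program Π → Set
Correct {Π} (program V supplementary R) =
  (∀ i → Correct (supplementary i)) ×
  (∀ n (ops : List (Operation Π n)) →
     let M       = λ i → interpret (supplementary i) n
         st      = stateAfter (machine R M) ops
         (𝒜 , σ) = st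
     in (∀ δ p k s → Semantics.Update.LegalUpdate M 𝒜 (onChange R δ k s) p σ) ×
        (∀ k q p → Semantics.Query.LegalQuery M 𝒜 (onQuery R k q) p σ ×
                   Answers Π (inputAfter Π n ops) k q p (answer (machine R M) st k q p)))

maximum : ∀ {m} → (Fin m → ℕ) → ℕ
maximum f = List.foldr _⊔_ 0 (List.tabulate f)

-- The factor contributed by a bound z ≤ g(n).  It is never 0: a loop whose
-- only branch is z = 0 costs as much as its body.
factor : ℕ → Bound → ℕ
factor n g = 1 ⊔ value g n

factors : ∀ {ℓ} → ℕ → Vec Bound ℓ → ℕ
factors n []       = 1
factors n (g ∷ gs) = factor n g * factors n gs

record Cost (Π : Problem) : Set where
  field
    ofChange : Change Π → ℕ
    ofQuery  : ∀ k → Symbol (queries Π) k → ℕ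

open Cost public

module Work {V : Vocabulary} (n : ℕ) (C : ∀ i → Cost (problem V i)) where

  module _ {loc : Schema} where

    mutual
      work : ∀ {v k} → Exp V loc v k → ℕ
      work (var _)            = 1
      work (aux _ ts)         = 1 ⊔ works ts
      work (local _ ts)       = 1 ⊔ works ts
      work (query {k} i q ts) = ofQuery (C i) k q ⊔ works ts
      work (t ⊕ u)            = 1 ⊔ work t ⊔ work u
      work (t ⊗ u)            = 1 ⊔ work t ⊔ work u
      work (ite c t u)        = 1 ⊔ work c ⊔ work t ⊔ work u
      work (getUnique g c)    = factor n g * work c
      work (t ≐ u)            = 1 ⊔ work t ⊔ work u
      work (t ≼ u)            = 1 ⊔ work t ⊔ work u
      work (bool _)           = 1
      work (neg c)            = 1 ⊔ work c
      work (c and d)          = 1 ⊔ work c ⊔ work d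
      work (c or d)           = 1 ⊔ work c ⊔ work d
      work (exists g c)       = factor n g * work c

      works : ∀ {v a} → Vec (Exp V loc v function) a → ℕ
      works []       = 0
      works (t ∷ ts) = work t ⊔ works ts

    workProc : ∀ {m v zs} → Proc V loc m v zs → ℕ
    workProc skip             = 1
    workProc (assign _ _ _ t) = work t
    workProc (P ⨾ Q)          = 1 ⊔ workProc P ⊔ workProc Q
    workProc (cond c P Q)     = 1 ⊔ work c ⊔ workProc P ⊔ workProc Q
    workProc (pardo g _ P)    = factor n g * workProc P
    workProc (invoke i δ ts)  = ofChange (C i) δ ⊔ works ts

    workMain : ∀ {v k} → Main V loc v k → ℕ
    workMain (return t)   = work t
    workMain (P ⨾ Q)      = 1 ⊔ workProc P ⊔ workMain Q
    workMain (cond c P Q) = 1 ⊔ work c ⊔ workMain P ⊔ workMain Q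

  workUpdate : ∀ {a k ar} → UpdateRule V a k ar → ℕ
  workUpdate π = workProc (P₁ π) ⊔ factors n (bounds π) * (workMain (P₂ π) ⊔ works (targets π))

  workQuery : ∀ {a k} → QueryRule V a k → ℕ
  workQuery π = workMain (QueryRule.procedure π)

cost : ∀ {Π} → Program Π → ℕ → Cost Π
cost (program V supplementary R) n = record
  { ofChange = λ δ → maximum (λ s → workUpdate (onChange R δ relation s)) ⊔
                     maximum (λ s → workUpdate (onChange R δ function s))
  ; ofQuery  = λ k q → workQuery (onQuery R k q)
  }
  where open Work n (λ i → cost (supplementary i) n)

-- f ∈ O(n^ε) for a positive rational ε = p/q, where f(n) ≤ c·n^(p/q) is
-- expressed as f(n)^q ≤ c^q·n^p.
_∈O[n^_] : (ℕ → ℕ) → ℚ → Set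
f ∈O[n^ ε ] = ∃[ c ] ∃[ n₀ ] (∀ n → n₀ ≤ n → f n ^ ↧ₙ ε ≤ c ^ ↧ₙ ε * n ^ ∣ ↥ ε ∣)

updateRuleWork : ∀ {Π} (V : Vocabulary) → (∀ i → Program (problem V i)) → (R : Rules Π V) →
                 ∀ δ k → Symbol (auxSchema V) k → ℕ → ℕ
updateRuleWork V supplementary R δ k s n =
  Work.workUpdate n (λ i → cost (supplementary i) n) (onChange R δ k s)

queryRuleWork : ∀ {Π} (V : Vocabulary) → (∀ i → Program (problem V i)) → (R : Rules Π V) →
                ∀ k → Symbol (queries Π) k → ℕ → ℕ
queryRuleWork V supplementary R k q n =
  Work.workQuery n (λ i → cost (supplementary i) n) (onQuery R k q)

HasWork : ∀ {Π} → Program Π → ((ℕ → ℕ) → Set) → Set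
HasWork (program V supplementary R) O =
  (∀ δ k s → O (updateRuleWork V supplementary R δ k s)) ×
  (∀ k q → O (queryRuleWork V supplementary R k q))

MaintainableInDynFOWithWork : Problem → ((ℕ → ℕ) → Set) → Set₁
MaintainableInDynFOWithWork Π O = Σ[ P ∈ Program Π ] (Correct P × HasWork P O)

Language : ℕ → Set₁
Language m = List (Fin m) → Set

record DFA (m : ℕ) : Set where
  field
    states : ℕ
    step   : Fin states → Fin m → Fin states
    begin  : Fin states
    final  : Fin states → Bool

  accepts : List (Fin m) → Bool
  accepts u = final (foldl step begin u)

Regular : ∀ {m} → Language m → Set
Regular {m} L = Σ[ A ∈ DFA m ] (∀ u → T (DFA.accepts A u) ⇔ L u)

module _ {m : ℕ} where

  wordSchema : Schema
  wordSchema = record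
    { size  = λ { relation → m ; function → 0 }
    ; arity = λ { relation _ → 1 ; function () }
    }

  -- w_i, with nothing for ε.
  letter : ∀ {n} → Structure wordSchema n → Fin n → Maybe (Fin m)
  letter w i = head (filterᵇ (λ σ → w relation σ (i ∷ [])) (allFin m))

  -- w_ℓ ∘ ⋯ ∘ w_r, which is the empty word for ℓ > r.
  infixWord : ∀ {n} → Structure wordSchema n → Fin n → Fin n → List (Fin m)
  infixWord {n} w ℓ r =
    mapMaybe (letter w) (filter (λ i → (toℕ ℓ ≤? toℕ i) ×-dec (toℕ i ≤? toℕ r)) (allFin n))

  reset : ∀ {n} → Fin n → Structure wordSchema n → Structure wordSchema n
  reset i w relation τ (j ∷ []) = w relation τ (j ∷ []) ∧ not (equal j i)
  reset i w function ()

  set : ∀ {n} → Fin m → Fin n → Structure wordSchema n → Structure wordSchema n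
  set σ i w relation τ (j ∷ []) =
    w relation τ (j ∷ []) ∨ (equal τ σ ∧ equal j i ∧ not (is-just (letter w i)))
  set σ i w function ()

-- Change zero is reset and change suc σ is set_σ.
RangeMember : ∀ {m} → Language m → Problem
RangeMember {m} L = record
  { input       = wordSchema {m}
  ; changes     = suc m
  ; changeArity = λ _ → 1
  ; queries     = record { size  = λ { relation → 1 ; function → 0 }
                         ; arity = λ { relation _ → 2 ; function () } }
  ; initial     = λ _ → emptyStructure
  ; perform     = λ { zero (i ∷ []) → reset i ; (suc σ) (i ∷ []) → set σ i }
  ; holds       = λ { w _ (ℓ ∷ r ∷ []) → L (infixWord w ℓ r) }
  ; returns     = λ _ ()
  }

{-# OPTIONS --safe #-}

-- Let k ≥ 2/ε be an integer and let b be the largest number with b ^ k < n.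
-- Division by b + 1 arranges the positions as the leaves of a tree of depth k
-- whose nodes have at most b + 1 children; the block of level h of a position
-- is its iterated quotient, and the position of a block among its siblings is
-- a remainder.  Quotients and remainders are first-order definable and stored.
-- For each node and each interval of its children the auxiliary structure
-- stores the function of states that the word below this interval induces.  A
-- change at p affects, on every level, only the intervals that contain the
-- block of p, and each of them is composed of the part to the left, the block
-- and the part to the right.  The parts do not contain p, and the new value of
-- the block is a composition of the same kind one level below, so that the new
-- values are given by quantifier-free conditions.  Hence an update has work
-- max(1, b)² ≤ n^ε.  A range is composed of suffixes of nodes on the way up, an
-- interval of children of one node, and prefixes on the way down, so that a
-- query has constant work.

module Submission where

open import Defs hiding (sym)
open import Data.Bool using (Bool; true; false; not; _∧_; _∨_; T)
import Data.Bool.ListAction as Bool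
open import Data.Bool.ListAction using (any; all)
open import Data.Bool.Properties using (T-∧; T-∨; T-≡; T?; ∧-identityʳ; ∧-zeroʳ; ∨-identityʳ; ∨-idem)
open import Data.Empty using (⊥)
open import Data.Fin using (Fin; zero; suc; toℕ; fromℕ<; combine; remQuot; _≟_; #_) renaming (_<_ to _<ᶠ_; _<?_ to _<ᶠ?_)
open import Data.Fin.Properties using (toℕ<n; toℕ-injective; toℕ-fromℕ<; fromℕ<-toℕ; remQuot-combine)
import Data.Fin.Properties as Fin
open import Data.Integer using (+0; +[1+_]; -[1+_]; ∣_∣)
open import Data.List using (List; []; _∷_; _++_; allFin; filter; filterᵇ; foldl; head; map; mapMaybe; tabulate)
open import Data.List.Membership.Propositional using (_∈_; find; lose)
open import Data.List.Membership.Propositional.Properties using (∈-allFin; ∈-cartesianProductWith⁺; ∈-filter⁺; ∈-filter⁻)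
open import Data.List.Properties using (filter-accept; filter-none; filter-reject; filter-≐)
open import Data.List.Relation.Unary.All using (All; []; _∷_)
import Data.List.Relation.Unary.All as All
import Data.List.Relation.Unary.All.Properties as All
open import Data.List.Relation.Unary.Any using (here; there)
open import Data.List.Relation.Unary.Any.Properties using (any⁺; any⁻)
open import Data.Maybe using (Maybe; just; nothing; is-just; _<∣>_)
import Data.Maybe.Properties as Maybe
open import Data.Nat using (ℕ; zero; suc; _+_; _*_; _^_; _⊔_; _/_; _%_; _≤_; _<_; _≤ᵇ_; _≤?_; _<?_; z≤n; s≤s; >-nonZero)
open import Data.Nat.Divisibility using (n∣m*n)
open import Data.Nat.DivMod
open import Data.Nat.Properties hiding (_≟_; _≤?_; _<?_)
open import Data.Product using (∃-syntax; _×_; _,_; proj₁; proj₂)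
open import Data.Rational using (ℚ; mkℚ; 0ℚ; ↥_; ↧ₙ_; positive) renaming (_<_ to _<ℚ_)
open import Data.Sum using (_⊎_; inj₁; inj₂)
open import Data.Unit using (⊤; tt)
open import Data.Vec using ([]; _∷_; lookup)
import Data.Vec.Properties as Vec
open import Function using (_⇔_; mk⇔; Equivalence; _∘_; id)
open import Relation.Binary.PropositionalEquality
open import Relation.Nullary using (Dec; yes; no; does; ¬_; contradiction)
open import Relation.Nullary.Decidable using (_×-dec_; dec-true; dec-false)
open import Relation.Unary using (Decidable)

open Equivalence using (to; from)

-- Integer roots

rootUpTo : ℕ → ℕ → ℕ → ℕ
rootUpTo k n zero    = 0
rootUpTo k n (suc m) with suc m ^ suc k <? n
... | yes _ = suc m
... | no  _ = rootUpTo k n m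

rootUpTo-< : ∀ (k n m : ℕ) → 0 < n → rootUpTo k n m ^ suc k < n
rootUpTo-< k n zero    0<n = 0<n
rootUpTo-< k n (suc m) 0<n with suc m ^ suc k <? n
... | yes p = p
... | no  _ = rootUpTo-< k n m 0<n

rootUpTo-max : ∀ k n m y → y ≤ m → y ^ suc k < n → y ≤ rootUpTo k n m
rootUpTo-max k n zero    y y≤m p = y≤m
rootUpTo-max k n (suc m) y y≤m p with suc m ^ suc k <? n
... | yes _ = y≤m
... | no ¬q with m≤n⇒m<n∨m≡n y≤m
...   | inj₁ (s≤s y≤m′) = rootUpTo-max k n m y y≤m′ p
...   | inj₂ refl       = contradiction p ¬q

m≤m^[1+k] : ∀ m k → m ≤ m ^ suc k
m≤m^[1+k] zero    k = z≤n
m≤m^[1+k] (suc m) k = ≤-trans (≤-reflexive (sym (*-identityʳ (suc m)))) (*-monoʳ-≤ (suc m) (m^n>0 (suc m) k))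

abstract
  -- The defining inequality is strict so that the power `suc k` of the root is still an element of
  -- [n], where the partial product is defined. All later uses of the root rest on `root-<` and
  -- `root-max`.
  root : ℕ → ℕ → ℕ
  root k n = rootUpTo k n n

  root-< : ∀ (k : ℕ) {n} → 0 < n → root k n ^ suc k < n
  root-< k {n} = rootUpTo-< k n n

  root-max : ∀ (k : ℕ) {n} y → y ^ suc k < n → y ≤ root k n
  root-max k {n} y p = rootUpTo-max k n n y (≤-trans (m≤m^[1+k] y k) (<⇒≤ p)) p

-- Division by the root plus one

abstract
  -- Both values stay in [n] because neither exceeds the dividend.
  quot rem : ∀ (k : ℕ) {n} → Fin n → Fin n
  quot k {n} x = fromℕ< (≤-<-trans (m/n≤m (toℕ x) (suc (root k n))) (toℕ<n x))
  rem  k {n} x = fromℕ< (≤-<-trans (m%n≤m (toℕ x) (suc (root k n))) (toℕ<n x))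

  toℕ-quot : ∀ (k : ℕ) {n} (x : Fin n) → toℕ (quot k x) ≡ toℕ x / suc (root k n)
  toℕ-quot k x = toℕ-fromℕ< _

  toℕ-rem : ∀ (k : ℕ) {n} (x : Fin n) → toℕ (rem k x) ≡ toℕ x % suc (root k n)
  toℕ-rem k x = toℕ-fromℕ< _

module _ (k : ℕ) {n : ℕ} where

  private
    B : ℕ
    B = suc (root k n)

  rem≤root : ∀ (x : Fin n) → toℕ (rem k x) ≤ root k n
  rem≤root x rewrite toℕ-rem k x = ≤-pred (m%n<n (toℕ x) B)

  rem+quot : ∀ (x : Fin n) → toℕ x ≡ toℕ (rem k x) + toℕ (quot k x) * B
  rem+quot x rewrite toℕ-rem k x | toℕ-quot k x = m≡m%n+[m/n]*n (toℕ x) B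

  quot-mono-≤ : ∀ {x y : Fin n} → toℕ x ≤ toℕ y → toℕ (quot k x) ≤ toℕ (quot k y)
  quot-mono-≤ {x} {y} x≤y rewrite toℕ-quot k x | toℕ-quot k y = /-monoˡ-≤ B x≤y

  quot-cancel-< : ∀ {x y : Fin n} → toℕ (quot k x) < toℕ (quot k y) → toℕ x < toℕ y
  quot-cancel-< {x} {y} p = ≰⇒> (λ y≤x → <⇒≱ p (quot-mono-≤ {y} {x} y≤x))

  rem-cancel-< : ∀ {x y : Fin n} → quot k x ≡ quot k y → toℕ (rem k x) < toℕ (rem k y) → toℕ x < toℕ y
  rem-cancel-< {x} {y} q r = subst₂ _<_
    (trans (cong (λ z → toℕ (rem k x) + toℕ z * B) (sym q)) (sym (rem+quot x))) (sym (rem+quot y))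
    (+-monoˡ-< (toℕ (quot k y) * B) r)

  rem-mono-< : ∀ {x y : Fin n} → quot k x ≡ quot k y → toℕ x < toℕ y → toℕ (rem k x) < toℕ (rem k y)
  rem-mono-< {x} {y} q r = +-cancelʳ-< (toℕ (quot k y) * B) _ _
    (subst₂ _<_ (trans (rem+quot x) (cong (λ z → toℕ (rem k x) + toℕ z * B) q)) (rem+quot y) r)

  -- Uniqueness of Euclidean division. The product with the divisor is expanded, as in the formula
  -- `divisionᶠ`, so that only the root itself is multiplied.
  rem-quot-unique : ∀ {x q r : Fin n} → toℕ r ≤ root k n → toℕ q * root k n + toℕ q + toℕ r ≡ toℕ x →
                    quot k x ≡ q × rem k x ≡ r
  rem-quot-unique {x} {q} {r} r≤ eq = toℕ-injective quot≡ , toℕ-injective rem≡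
    where
    open ≡-Reasoning
    r<B : toℕ r < B
    r<B = s≤s r≤
    x≡ : toℕ x ≡ toℕ r + toℕ q * B
    x≡ = begin
      toℕ x                                ≡⟨ sym eq ⟩
      toℕ q * root k n + toℕ q + toℕ r     ≡⟨ +-comm (toℕ q * root k n + toℕ q) (toℕ r) ⟩
      toℕ r + (toℕ q * root k n + toℕ q)   ≡⟨ cong (toℕ r +_) (+-comm (toℕ q * root k n) (toℕ q)) ⟩
      toℕ r + (toℕ q + toℕ q * root k n)   ≡⟨ cong (toℕ r +_) (*-suc (toℕ q) (root k n)) ⟨
      toℕ r + toℕ q * B                    ∎
    quot≡ : toℕ (quot k x) ≡ toℕ q
    quot≡ = begin
      toℕ (quot k x)                   ≡⟨ toℕ-quot k x ⟩
      toℕ x / B                        ≡⟨ cong (_/ B) x≡ ⟩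
      (toℕ r + toℕ q * B) / B          ≡⟨ +-distrib-/-∣ʳ (toℕ r) {toℕ q * B} {B} (n∣m*n (toℕ q) {B}) ⟩
      toℕ r / B + toℕ q * B / B        ≡⟨ cong₂ _+_ (m<n⇒m/n≡0 {m = toℕ r} {n = B} r<B) (m*n/n≡m (toℕ q) B) ⟩
      toℕ q                            ∎
    rem≡ : toℕ (rem k x) ≡ toℕ r
    rem≡ = begin
      toℕ (rem k x)                    ≡⟨ toℕ-rem k x ⟩
      toℕ x % B                        ≡⟨ cong (_% B) x≡ ⟩
      (toℕ r + toℕ q * B) % B          ≡⟨ [m+kn]%n≡m%n (toℕ r) (toℕ q) B ⟩
      toℕ r % B                        ≡⟨ m<n⇒m%n≡m {n = B} {m = toℕ r} r<B ⟩
      toℕ r                            ∎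

-- The hierarchy of blocks

-- The number of the block of length (root k n + 1) ^ h that contains a position.
block : ∀ (k : ℕ) {n} → ℕ → Fin n → Fin n
block k zero    x = x
block k (suc h) x = quot k (block k h x)

-- Each level divides by `B` and thereby takes one factor `B` off the bound.
block-bound : ∀ (k : ℕ) {n} h j (x : Fin n) → toℕ x < suc (root k n) ^ (h + j) → toℕ (block k h x) < suc (root k n) ^ j
block-bound k zero    j x p = p
block-bound k {n} (suc h) j x p = subst (_< B ^ j) (sym (toℕ-quot k (block k h x)))
  (m<n*o⇒m/o<n (subst (toℕ (block k h x) <_) (*-comm B (B ^ j))
    (block-bound k h (suc j) x (subst (λ z → toℕ x < B ^ z) (sym (+-suc h j)) p))))
  where
  B : ℕ
  B = suc (root k n)

-- Maximality of the root gives n ≤ (root + 1) ^ (k + 1), so that after k + 1 divisions every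
-- position has reached block 0.
block-top : ∀ (k : ℕ) {n} (x y : Fin n) → block k (suc k) x ≡ block k (suc k) y
block-top k {n} x y = toℕ-injective (trans (top x) (sym (top y)))
  where
  n≤ : n ≤ suc (root k n) ^ suc k
  n≤ = ≮⇒≥ λ p → 1+n≰n (root-max k (suc (root k n)) p)
  top : ∀ z → toℕ (block k (suc k) z) ≡ 0
  top z = n<1⇒n≡0 (block-bound k (suc k) 0 z
    (<-≤-trans (toℕ<n z) (subst (λ e → n ≤ suc (root k n) ^ e) (sym (+-identityʳ (suc k))) n≤)))

block-cancel-< : ∀ (k : ℕ) {n} h {x y : Fin n} → toℕ (block k h x) < toℕ (block k h y) → toℕ x < toℕ y
block-cancel-< k zero    p = p
block-cancel-< k (suc h) {x} {y} p =
  block-cancel-< k h (quot-cancel-< k {x = block k h x} {block k h y} p)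

-- Quantifiers over [n] and partial arithmetic

T-does : ∀ {A : Set} (a? : Dec A) → T (does a?) ⇔ A
T-does (yes a) = mk⇔ (λ _ → a) _
T-does (no ¬a) = mk⇔ (λ ()) ¬a

any-allFin : ∀ {n} {p : Fin n → Bool} → T (any p (allFin n)) ⇔ (∃[ x ] T (p x))
any-allFin {n} {p} = mk⇔ (λ t → let x , _ , px = find (any⁻ p (allFin n) t) in x , px)
                         (λ (x , px) → any⁺ p (lose (∈-allFin x) px))

all-allFin : ∀ {n} {p : Fin n → Bool} → T (all p (allFin n)) ⇔ (∀ x → T (p x))
all-allFin {n} {p} = mk⇔ (λ t x → All.lookup (All.all⁺ p (allFin n) t) (∈-allFin x))
                         (λ f → All.all⁻ p (All.tabulate {xs = allFin n} (λ {x} _ → f x)))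

element-< : ∀ {n m} (m<n : m < n) → element n m ≡ just (fromℕ< m<n)
element-< {n} {m} m<n with m <? n
... | yes p = refl
... | no ¬p = contradiction m<n ¬p

element-≥ : ∀ {n m} → n ≤ m → element n m ≡ nothing
element-≥ {n} {m} n≤m with m <? n
... | yes p = contradiction p (≤⇒≯ n≤m)
... | no _  = refl

element-toℕ : ∀ {n} (x : Fin n) → element n (toℕ x) ≡ just x
element-toℕ x = trans (element-< (toℕ<n x)) (cong just (fromℕ<-toℕ x _))

-- An overflowing summand makes the sum overflow, so undefinedness propagates exactly as it should.
addition-element : ∀ {n} a b → lift₂ addition (element n a) (element n b) ≡ element n (a + b)
addition-element {n} a b with a <? n | b <? n
... | yes p | yes q = cong (element n) (cong₂ _+_ (toℕ-fromℕ< p) (toℕ-fromℕ< q))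
... | no ¬p | yes q = sym (element-≥ (≤-trans (≮⇒≥ ¬p) (m≤m+n a b)))
... | no ¬p | no ¬q = sym (element-≥ (≤-trans (≮⇒≥ ¬p) (m≤m+n a b)))
... | yes p | no ¬q = sym (element-≥ (≤-trans (≮⇒≥ ¬q) (m≤n+m b a)))

-- A factor 0 could hide an overflow of the other factor; the hypothesis on `b` excludes this.
multiplication-element : ∀ {n} a b → a < n → (n ≤ b → n ≤ a * b) →
                         lift₂ multiplication (element n a) (element n b) ≡ element n (a * b)
multiplication-element {n} a b a<n overflow with a <? n | b <? n
... | yes p | yes q = cong (element n) (cong₂ _*_ (toℕ-fromℕ< p) (toℕ-fromℕ< q))
... | yes p | no ¬q = sym (element-≥ (overflow (≮⇒≥ ¬q)))
... | no ¬p | _     = contradiction a<n ¬p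

equal-element : ∀ {n} a b → T (lift₂ equal (element n a) (element n b)) ⇔ (a ≡ b × a < n)
equal-element {n} a b with a <? n | b <? n
... | yes p | yes q = mk⇔
        (λ t → trans (sym (toℕ-fromℕ< p)) (trans (cong toℕ (to (T-does (fromℕ< p ≟ fromℕ< q)) t)) (toℕ-fromℕ< q)) , p)
        (λ (eq , _) → from (T-does (fromℕ< p ≟ fromℕ< q))
                        (toℕ-injective (trans (toℕ-fromℕ< p) (trans eq (sym (toℕ-fromℕ< q))))))
... | no ¬p | _     = mk⇔ (λ ()) (λ (_ , p) → ¬p p)
... | yes p | no ¬q = mk⇔ (λ ()) (λ { (refl , _) → ¬q p })

-- First-order definitions of root, quotient and remainder

module _ {τ : Schema} where

  powerᶠ : ∀ {v} → ℕ → FO τ v function → FO τ v function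
  powerᶠ zero    t = t
  powerᶠ (suc k) t = t ⊗ powerᶠ k t

  -- An undefined term is not even equal to itself.
  definedᶠ : ∀ {v} → FO τ v function → FO τ v relation
  definedᶠ t = t ≐ t

  -- `powerᶠ k` is the power `suc k`, and being defined means being less than n. The root is thus
  -- the largest element whose power is defined.
  rootᶠ : ℕ → ∀ {v} → FO τ (suc v) relation
  rootᶠ k = definedᶠ (powerᶠ k (var zero)) and
            forAll (neg (definedᶠ (powerᶠ k (var zero))) or (var zero ≼ var (suc zero)))

  -- x = (q b + q) + r with r ≤ b for the root b: the divisor b + 1 itself
  -- need not be an element of [n].
  divisionᶠ : ℕ → ∀ {v} → Fin (suc v) → Fin (suc v) → Fin (suc v) → FO τ (suc v) relation
  divisionᶠ k x q r =
    rootᶠ k and ((var r ≼ var zero) and ((((var q ⊗ var zero) ⊕ var q) ⊕ var r) ≐ var x))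

  -- Under the two quantifiers, variable 0 is the root, 1 the other result of the division, 2 the
  -- value to be defined and 3 the dividend.
  quotᶠ remᶠ : ℕ → FO τ 2 relation
  quotᶠ k = exists (exists (divisionᶠ k (# 3) (# 2) (# 1)))
  remᶠ  k = exists (exists (divisionᶠ k (# 3) (# 1) (# 2)))

  module _ {n : ℕ} (𝒜 : Structure τ n) where

    eval-power : ∀ {v} k (t : FO τ v function) {e} {x : Fin n} → evalFO 𝒜 t e ≡ just x →
                 evalFO 𝒜 (powerᶠ k t) e ≡ element n (toℕ x ^ suc k)
    eval-power zero    t {x = x} p =
      trans p (trans (sym (element-toℕ x)) (cong (element n) (sym (*-identityʳ (toℕ x)))))
    eval-power (suc k) t {e} {x} p =
      trans (cong₂ (lift₂ multiplication) (trans p (sym (element-toℕ x))) (eval-power k t p))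
            (multiplication-element (toℕ x) (toℕ x ^ suc k) (toℕ<n x) (overflow (toℕ x)))
      where
      -- For base 0 the power is itself 0; otherwise multiplying by the base cannot make it smaller.
      overflow : ∀ a → n ≤ a ^ suc k → n ≤ a * a ^ suc k
      overflow zero    n≤ = n≤
      overflow (suc a) n≤ = ≤-trans n≤ (m≤m+n _ _)

    eval-defined : ∀ {v} k (t : FO τ v function) {e} {x : Fin n} → evalFO 𝒜 t e ≡ just x →
                   T (evalFO 𝒜 (definedᶠ (powerᶠ k t)) e) ⇔ (toℕ x ^ suc k < n)
    eval-defined k t {e} {x} p
      rewrite eval-power k t p = mk⇔ (proj₂ ∘ to equal⇔) (λ q → from equal⇔ (refl , q))
      where equal⇔ = equal-element {n} (toℕ x ^ suc k) (toℕ x ^ suc k)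

    eval-root : ∀ k {v} (x : Fin n) (e : Tuple n v) → T (evalFO 𝒜 (rootᶠ k) (x ∷ e)) ⇔ (toℕ x ≡ root k n)
    eval-root k x e = mk⇔ sound complete
      where
      sound : T (evalFO 𝒜 (rootᶠ k) (x ∷ e)) → toℕ x ≡ root k n
      sound t with to T-∧ t
      ... | def , largest = ≤-antisym x≤ (root≤x largest′)
        where
        x<n = to (eval-defined k (var zero) refl) def
        0<n = ≤-<-trans z≤n (toℕ<n x)
        x≤ : toℕ x ≤ root k n
        x≤ = root-max k (toℕ x) x<n
        root<n : root k n < n
        root<n = ≤-<-trans (m≤m^[1+k] (root k n) k) (root-< k 0<n)
        -- The universal quantifier is instantiated at the root itself, which lies in [n] because it
        -- is at most its own power.
        b = fromℕ< root<n
        largest′ = to T-∨ (to all-allFin largest b)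
        root≤x : _ → root k n ≤ toℕ x
        root≤x (inj₁ ¬def) = contradiction
          (from (eval-defined k (var zero) {b ∷ x ∷ e} refl)
                (subst (λ z → z ^ suc k < n) (sym (toℕ-fromℕ< root<n)) (root-< k 0<n)))
          (¬T ¬def)
          where
          ¬T : ∀ {b} → T (not b) → ¬ T b
          ¬T {false} _ ()
        root≤x (inj₂ b≤x) = subst (_≤ toℕ x) (toℕ-fromℕ< root<n) (≤ᵇ⇒≤ _ _ b≤x)
      complete : toℕ x ≡ root k n → T (evalFO 𝒜 (rootᶠ k) (x ∷ e))
      complete eq = from T-∧
        ( from (eval-defined k (var zero) refl)
            (subst (λ z → z ^ suc k < n) (sym eq) (root-< k (≤-<-trans z≤n (toℕ<n x))))
        , from all-allFin (λ y → from T-∨ (larger y)))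
        where
        larger : ∀ y → T (not (evalFO 𝒜 (definedᶠ (powerᶠ k (var zero))) (y ∷ x ∷ e))) ⊎
                       T (evalFO 𝒜 (var zero ≼ var (suc zero)) (y ∷ x ∷ e))
        larger y with evalFO 𝒜 (definedᶠ (powerᶠ k (var zero))) (y ∷ x ∷ e) in def
        ... | false = inj₁ tt
        ... | true  = inj₂ (≤⇒≤ᵇ (subst (toℕ y ≤_) (sym eq)
                        (root-max k (toℕ y) (to (eval-defined k (var zero) refl) (from T-≡ def)))))

    -- The sum is undefined only if the total is at least n, and then the total cannot be x. Hence
    -- the partial equation agrees with the one on natural numbers.
    eval-division : ∀ k {v} (i j l : Fin (suc v)) (b : Fin n) (e : Tuple n v) →
                    let x = lookup (b ∷ e) i; q = lookup (b ∷ e) j; r = lookup (b ∷ e) l in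
                    T (evalFO 𝒜 (divisionᶠ k i j l) (b ∷ e)) ⇔ (toℕ b ≡ root k n × quot k x ≡ q × rem k x ≡ r)
    eval-division k {v} i j l b e = mk⇔ sound complete
      where
      x q r : Fin n
      x = lookup (b ∷ e) i
      q = lookup (b ∷ e) j
      r = lookup (b ∷ e) l
      sum : FO τ (suc v) function
      sum = ((var j ⊗ var zero) ⊕ var j) ⊕ var l
      sum≡ : evalFO 𝒜 sum (b ∷ e) ≡ element n (toℕ q * toℕ b + toℕ q + toℕ r)
      sum≡ = trans (cong₂ (lift₂ addition)
                     (trans (cong (lift₂ addition (element n (toℕ q * toℕ b))) (sym (element-toℕ q)))
                            (addition-element (toℕ q * toℕ b) (toℕ q)))
                     (sym (element-toℕ r)))
                   (addition-element (toℕ q * toℕ b + toℕ q) (toℕ r))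
      eq⇔ : T (evalFO 𝒜 (sum ≐ var i) (b ∷ e)) ⇔
            (toℕ q * toℕ b + toℕ q + toℕ r ≡ toℕ x × toℕ q * toℕ b + toℕ q + toℕ r < n)
      eq⇔ = subst₂ (λ s t → T (lift₂ equal s t) ⇔ (total ≡ toℕ x × total < n)) (sym sum≡) (element-toℕ x)
                   (equal-element total (toℕ x))
        where
        total : ℕ
        total = toℕ q * toℕ b + toℕ q + toℕ r
      sound : T (evalFO 𝒜 (divisionᶠ k i j l) (b ∷ e)) → toℕ b ≡ root k n × quot k x ≡ q × rem k x ≡ r
      sound t with to T-∧ t
      ... | isRoot , rest with to T-∧ rest
      ...   | r≤ , eq = b≡ , rem-quot-unique k
                          (subst (toℕ r ≤_) b≡ (≤ᵇ⇒≤ _ _ r≤))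
                          (subst (λ z → toℕ q * z + toℕ q + toℕ r ≡ toℕ x) b≡ (proj₁ (to eq⇔ eq)))
        where
        b≡ : toℕ b ≡ root k n
        b≡ = to (eval-root k b e) isRoot
      complete : toℕ b ≡ root k n × quot k x ≡ q × rem k x ≡ r → T (evalFO 𝒜 (divisionᶠ k i j l) (b ∷ e))
      complete (b≡ , q≡ , r≡) = from T-∧ (from (eval-root k b e) b≡ , from T-∧
        ( ≤⇒≤ᵇ (subst₂ _≤_ (cong toℕ r≡) (sym b≡) (rem≤root k x))
        , from eq⇔ (sum≡x , subst (_< n) (sym sum≡x) (toℕ<n x))))
        where
        open ≡-Reasoning
        sum≡x : toℕ q * toℕ b + toℕ q + toℕ r ≡ toℕ x
        sum≡x = begin
          toℕ q * toℕ b + toℕ q + toℕ r                   ≡⟨ +-comm (toℕ q * toℕ b + toℕ q) (toℕ r) ⟩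
          toℕ r + (toℕ q * toℕ b + toℕ q)                 ≡⟨ cong (toℕ r +_) (+-comm (toℕ q * toℕ b) (toℕ q)) ⟩
          toℕ r + (toℕ q + toℕ q * toℕ b)                 ≡⟨ cong (toℕ r +_) (*-suc (toℕ q) (toℕ b)) ⟨
          toℕ r + toℕ q * suc (toℕ b)                     ≡⟨ cong₂ (λ u w → toℕ u + toℕ w * suc (toℕ b)) r≡ q≡ ⟨
          toℕ (rem k x) + toℕ (quot k x) * suc (toℕ b)    ≡⟨ cong (λ z → toℕ (rem k x) + toℕ (quot k x) * suc z) b≡ ⟩
          toℕ (rem k x) + toℕ (quot k x) * suc (root k n) ≡⟨ rem+quot k x ⟨
          toℕ x                                           ∎

    -- The given position witnesses 0 < n, which places the root in [n].
    rootElement : ℕ → Fin n → Fin n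
    rootElement k x = fromℕ< (≤-<-trans (m≤m^[1+k] (root k n) k) (root-< k (≤-<-trans z≤n (toℕ<n x))))

    eval-quot : ∀ k (q x : Fin n) → T (evalFO 𝒜 (quotᶠ k) (q ∷ x ∷ [])) ⇔ (q ≡ quot k x)
    eval-quot k q x = mk⇔ sound complete
      where
      sound : T (evalFO 𝒜 (quotᶠ k) (q ∷ x ∷ [])) → q ≡ quot k x
      sound t with to any-allFin t
      ... | r , t′ with to any-allFin t′
      ...   | b , t″ = sym (proj₁ (proj₂ (to (eval-division k (# 3) (# 2) (# 1) b (r ∷ q ∷ x ∷ [])) t″)))
      complete : q ≡ quot k x → T (evalFO 𝒜 (quotᶠ k) (q ∷ x ∷ []))
      complete eq = from any-allFin (rem k x , from any-allFin (rootElement k x ,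
        from (eval-division k (# 3) (# 2) (# 1) (rootElement k x) (rem k x ∷ q ∷ x ∷ []))
          (toℕ-fromℕ< _ , sym eq , refl)))

    eval-rem : ∀ k (r x : Fin n) → T (evalFO 𝒜 (remᶠ k) (r ∷ x ∷ [])) ⇔ (r ≡ rem k x)
    eval-rem k r x = mk⇔ sound complete
      where
      sound : T (evalFO 𝒜 (remᶠ k) (r ∷ x ∷ [])) → r ≡ rem k x
      sound t with to any-allFin t
      ... | q , t′ with to any-allFin t′
      ...   | b , t″ = sym (proj₂ (proj₂ (to (eval-division k (# 3) (# 1) (# 2) b (q ∷ r ∷ x ∷ [])) t″)))
      complete : r ≡ rem k x → T (evalFO 𝒜 (remᶠ k) (r ∷ x ∷ []))
      complete eq = from any-allFin (quot k x , from any-allFin (rootElement k x ,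
        from (eval-division k (# 3) (# 1) (# 2) (rootElement k x) (quot k x ∷ r ∷ x ∷ []))
          (toℕ-fromℕ< _ , refl , sym eq)))

rootBound : ℕ → Bound
rootBound k = record
  { value   = root k
  ; formula = rootᶠ k
  ; defines = λ n x → eval-root emptyStructure k x []
  }

-- Filtered enumerations

-- Once an element of `B` has been met, no element of `A` can follow, so the filtered list changes
-- from `A` to `B` only once.
filter-tabulate-⊎ : ∀ {X : Set} {P A B : X → Set} (P? : Decidable P) (A? : Decidable A) (B? : Decidable B) →
                    (∀ x → P x ⇔ (A x ⊎ B x)) →
                    ∀ {n} (f : Fin n → X) → (∀ i j → A (f i) → B (f j) → toℕ i < toℕ j) →
                    filter P? (tabulate f) ≡ filter A? (tabulate f) ++ filter B? (tabulate f)
filter-tabulate-⊎ P? A? B? P⇔ {zero}  f A<B = refl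
filter-tabulate-⊎ P? A? B? P⇔ {suc n} f A<B with A? (f zero) | B? (f zero)
... | yes a | yes b = contradiction (A<B zero zero a b) (λ ())
... | yes a | no ¬b = trans (filter-accept P? (from (P⇔ _) (inj₁ a)))
        (cong (f zero ∷_) (filter-tabulate-⊎ P? A? B? P⇔ (f ∘ suc) (λ i j a b → ≤-pred (A<B (suc i) (suc j) a b))))
... | no ¬a | no ¬b = trans (filter-reject P? (λ p → ¬either (to (P⇔ _) p)))
        (filter-tabulate-⊎ P? A? B? P⇔ (f ∘ suc) (λ i j a b → ≤-pred (A<B (suc i) (suc j) a b)))
  where
  ¬either : ¬ (_ ⊎ _)
  ¬either (inj₁ a) = ¬a a
  ¬either (inj₂ b) = ¬b b
... | no ¬a | yes b = trans (filter-accept P? (from (P⇔ _) (inj₂ b)))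
        (trans (cong (f zero ∷_) (filter-tabulate-⊎ P? A? B? P⇔ (f ∘ suc) (λ i j a b → ≤-pred (A<B (suc i) (suc j) a b))))
               (trans (cong (λ xs → f zero ∷ xs ++ filter B? (tabulate (f ∘ suc))) noA)
                      (cong (_++ f zero ∷ filter B? (tabulate (f ∘ suc))) (sym noA))))
  where
  noA : filter A? (tabulate (f ∘ suc)) ≡ []
  noA = filter-none A? (All.tabulate⁺ (λ i a → contradiction (A<B (suc i) zero a b) (λ ())))

filter-allFin-≡ : ∀ {n} {P : Fin n → Set} (P? : Decidable P) {x : Fin n} → (∀ y → P y ⇔ y ≡ x) →
                  filter P? (allFin n) ≡ x ∷ []
filter-allFin-≡ {n} {P} P? {x} P⇔ = filter-tabulate-≡ id x (λ y → P⇔ y)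
  where
  filter-tabulate-≡ : ∀ {k} (f : Fin k → Fin n) i → (∀ j → P (f j) ⇔ j ≡ i) → filter P? (tabulate f) ≡ f i ∷ []
  filter-tabulate-≡ f zero    h = trans (filter-accept P? (from (h zero) refl))
    (cong (f zero ∷_) (filter-none P? (All.tabulate⁺ (λ j p → contradiction (to (h (suc j)) p) (λ ())))))
  filter-tabulate-≡ f (suc i) h = trans (filter-reject P? (λ p → contradiction (to (h zero) p) (λ ())))
    (filter-tabulate-≡ (f ∘ suc) i (λ j → mk⇔ (Fin.suc-injective ∘ to (h (suc j))) (from (h (suc j)) ∘ cong suc)))

-- Segments of blocks and the functions of states they induce

-- The endpoints of an interval of remainders: unbounded for zero.
Within : Fin 2 → ∀ {n} → Fin n → Fin n → Set
Within zero    x y = ⊤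
Within (suc _) x y = x <ᶠ y

Within? : ∀ a {n} (x y : Fin n) → Dec (Within a x y)
Within? zero    x y = yes tt
Within? (suc _) x y = x <ᶠ? y

Within-transˡ : ∀ a {n} {x y z : Fin n} → Within a x y → y <ᶠ z → Within a x z
Within-transˡ zero    _   _   = tt
Within-transˡ (suc _) x<y y<z = <-trans x<y y<z

Within-transʳ : ∀ a {n} {x y z : Fin n} → x <ᶠ y → Within a y z → Within a x z
Within-transʳ zero    _   _   = tt
Within-transʳ (suc _) x<y y<z = <-trans x<y y<z

module Products {m : ℕ} (A : DFA m) (k : ℕ) where

  open DFA A using (states; step)

  Q : Set
  Q = Fin states

  stepMaybe : Maybe (Fin m) → Q → Q
  stepMaybe nothing  q = q
  stepMaybe (just σ) q = step q σ

  module _ {n : ℕ} where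

    -- Endpoints are excluded, so the siblings on either side of a child are cut off by its own
    -- remainder, without successors or predecessors.
    Segment : Fin 2 → Fin 2 → Fin n → Fin n → Fin n → Fin n → Set
    Segment a z c i j y = quot k y ≡ c × Within a i (rem k y) × Within z (rem k y) j

    Segment? : ∀ a z c i j → Decidable (Segment a z c i j)
    Segment? a z c i j y = (quot k y ≟ c) ×-dec (Within? a i (rem k y) ×-dec Within? z (rem k y) j)

    Between : Fin n → Fin n → Fin n → Set
    Between u v y = u <ᶠ y × y <ᶠ v

    Between? : ∀ u v → Decidable (Between u v)
    Between? u v y = (u <ᶠ? y) ×-dec (y <ᶠ? v)

    module _ (w : Fin n → Maybe (Fin m)) where

      run : List (Fin n) → Q → Q
      run xs q = foldl step q (mapMaybe w xs)

      run-∷ : ∀ x xs q → run (x ∷ xs) q ≡ run xs (stepMaybe (w x) q)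
      run-∷ x xs q with w x
      ... | nothing = refl
      ... | just σ  = refl

      run-++ : ∀ xs ys q → run (xs ++ ys) q ≡ run ys (run xs q)
      run-++ []       ys q = refl
      run-++ (x ∷ xs) ys q with w x
      ... | nothing = run-++ xs ys q
      ... | just σ  = run-++ xs ys (step q σ)

      runBlocks : ∀ h {P : Fin n → Set} → Decidable P → Q → Q
      runBlocks h P? = run (filter (P? ∘ block k h) (allFin n))

      runBlocks-cong : ∀ h {P R : Fin n → Set} (P? : Decidable P) (R? : Decidable R) →
                       (∀ y → P y ⇔ R y) → ∀ q → runBlocks h P? q ≡ runBlocks h R? q
      runBlocks-cong h P? R? P⇔R q = cong (λ xs → run xs q)
        (filter-≐ (P? ∘ block k h) (R? ∘ block k h) ((λ {x} → to (P⇔R _)) , (λ {x} → from (P⇔R _))) (allFin n))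

      -- By `block-cancel-<`, positions inherit the order of their blocks.
      runBlocks-⊎ : ∀ h {P A B : Fin n → Set} (P? : Decidable P) (A? : Decidable A) (B? : Decidable B) →
                    (∀ y → P y ⇔ (A y ⊎ B y)) → (∀ x y → A x → B y → x <ᶠ y) →
                    ∀ q → runBlocks h P? q ≡ runBlocks h B? (runBlocks h A? q)
      runBlocks-⊎ h P? A? B? P⇔ A<B q = trans
        (cong (λ xs → run xs q)
          (filter-tabulate-⊎ (P? ∘ block k h) (A? ∘ block k h) (B? ∘ block k h) (λ x → P⇔ (block k h x)) id
            (λ x y a b → block-cancel-< k h (A<B _ _ a b))))
        (run-++ (filter (A? ∘ block k h) (allFin n)) (filter (B? ∘ block k h) (allFin n)) q)

      -- First the blocks below `v` are split off, then `v` itself. Updates and queries both rest on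
      -- this decomposition.
      runBlocks-around : ∀ h {P A B : Fin n → Set} (P? : Decidable P) (A? : Decidable A) (B? : Decidable B) v →
                         P v → (∀ y → A y ⇔ (P y × y <ᶠ v)) → (∀ y → B y ⇔ (P y × v <ᶠ y)) →
                         ∀ q → runBlocks h P? q ≡
                               runBlocks h B? (runBlocks h (_≟ v) (runBlocks h A? q))
      runBlocks-around h {P} {A} {B} P? A? B? v Pv A⇔ B⇔ q = trans
        (runBlocks-⊎ h P? A? P≥v? P⇔ (λ x y a (_ , v≤y) → <-≤-trans (proj₂ (to (A⇔ x) a)) v≤y) q)
        (runBlocks-⊎ h P≥v? (_≟ v) B? P≥v⇔ (λ { x y refl b → proj₂ (to (B⇔ y) b) }) (runBlocks h A? q))
        where
        P≥v? : Decidable (λ y → P y × toℕ v ≤ toℕ y)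
        P≥v? y = P? y ×-dec (toℕ v ≤? toℕ y)
        P⇔ : ∀ y → P y ⇔ (A y ⊎ P y × toℕ v ≤ toℕ y)
        P⇔ y = mk⇔ split (λ { (inj₁ a) → proj₁ (to (A⇔ y) a) ; (inj₂ (p , _)) → p })
          where
          split : P y → A y ⊎ P y × toℕ v ≤ toℕ y
          split p with y <ᶠ? v
          ... | yes y<v = inj₁ (from (A⇔ y) (p , y<v))
          ... | no  y≮v = inj₂ (p , ≮⇒≥ y≮v)
        P≥v⇔ : ∀ y → (P y × toℕ v ≤ toℕ y) ⇔ (y ≡ v ⊎ B y)
        P≥v⇔ y = mk⇔ split λ { (inj₁ refl) → Pv , ≤-refl
                             ; (inj₂ b) → proj₁ (to (B⇔ y) b) , <⇒≤ (proj₂ (to (B⇔ y) b)) }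
          where
          split : P y × toℕ v ≤ toℕ y → y ≡ v ⊎ B y
          split (p , v≤y) with y ≟ v
          ... | yes eq = inj₁ eq
          ... | no neq = inj₂ (from (B⇔ y) (p , ≤∧≢⇒< v≤y (λ eq → neq (toℕ-injective (sym eq)))))

      -- The function of states that the word of a segment of the blocks of
      -- level h, or the letter of a block of level 0, induces.
      transition : ℕ → Fin 2 → Fin 2 → Fin n → Fin n → Fin n → Q → Q
      transition zero    a z c i j = stepMaybe (w c)
      transition (suc h) a z c i j = runBlocks h (Segment? a z c i j)

      runBlocks-letter : ∀ c q → runBlocks 0 (_≟ c) q ≡ stepMaybe (w c) q
      runBlocks-letter c q = trans (cong (λ xs → run xs q) (filter-allFin-≡ (_≟ c) (λ y → mk⇔ id id))) (run-∷ c [] q)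

      -- Among siblings, the order of the blocks is the order of their remainders.
      transition-around : ∀ h a z {i j v} → Within a i (rem k v) → Within z (rem k v) j → ∀ q →
                          transition (suc h) a z (quot k v) i j q ≡
                          transition (suc h) (suc zero) z (quot k v) (rem k v) j
                            (runBlocks h (_≟ v) (transition (suc h) a (suc zero) (quot k v) i (rem k v) q))
      transition-around h a z {i} {j} {v} i<v v<j = runBlocks-around h
        (Segment? a z _ i j) (Segment? a (suc zero) _ i _) (Segment? (suc zero) z _ _ j) v (refl , i<v , v<j)
        (λ y → mk⇔ (λ (q , i<y , y<v) → (q , i<y , Within-transʳ z y<v v<j) , rem-cancel-< k q y<v)
                   (λ ((q , i<y , _) , y<v) → q , i<y , rem-mono-< k q y<v))
        (λ y → mk⇔ (λ (q , v<y , y<j) → (q , Within-transˡ a i<v v<y , y<j) , rem-cancel-< k (sym q) v<y)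
                   (λ ((q , _ , y<j) , v<y) → q , rem-mono-< k (sym q) v<y , y<j))

      -- A block is the uncut segment of its own children. Under flag 0 the endpoint `rem k v` is a
      -- filler, chosen within the range of remainders.
      block-around : ∀ h v q →
                     runBlocks (suc h) (_≟ quot k v) q ≡
                     transition (suc h) (suc zero) zero (quot k v) (rem k v) (rem k v)
                       (runBlocks h (_≟ v) (transition (suc h) zero (suc zero) (quot k v) (rem k v) (rem k v) q))
      block-around h v q = trans
        (runBlocks-cong h (λ y → quot k y ≟ quot k v) (Segment? zero zero _ (rem k v) (rem k v))
          (λ y → mk⇔ (λ eq → eq , tt , tt) proj₁) q)
        (transition-around h zero zero {rem k v} {rem k v} {v} tt tt q)

      -- Quotients are monotone, so everything between two siblings is a sibling of both.
      between-same : ∀ h {u v} → quot k u ≡ quot k v → ∀ q →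
                     runBlocks h (Between? u v) q ≡
                     transition (suc h) (suc zero) (suc zero) (quot k u) (rem k u) (rem k v) q
      between-same h {u} {v} u~v = runBlocks-cong h (Between? u v) (Segment? (suc zero) (suc zero) _ _ _)
        (λ y → mk⇔ (λ (u<y , y<v) → let y~u = quot-between u<y y<v in
                       y~u , rem-mono-< k (sym y~u) u<y , rem-mono-< k (trans y~u u~v) y<v)
                   (λ (y~u , u<y , y<v) → rem-cancel-< k (sym y~u) u<y , rem-cancel-< k (trans y~u u~v) y<v))
        where
        quot-between : ∀ {y} → u <ᶠ y → y <ᶠ v → quot k y ≡ quot k u
        quot-between {y} u<y y<v = toℕ-injective (≤-antisym
          (≤-trans (quot-mono-≤ k {x = y} {v} (<⇒≤ y<v)) (≤-reflexive (cong toℕ (sym u~v))))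
          (quot-mono-≤ k {x = u} {y} (<⇒≤ u<y)))

      -- Three runs: the siblings to the right of `u`, the children of the blocks strictly between
      -- the two parents, and the siblings to the left of `v`. The middle run is the same task one
      -- level up.
      between-different : ∀ h {u v} → quot k u <ᶠ quot k v → ∀ q →
                          runBlocks h (Between? u v) q ≡
                          transition (suc h) zero (suc zero) (quot k v) (rem k v) (rem k v)
                            (runBlocks (suc h) (Between? (quot k u) (quot k v))
                              (transition (suc h) (suc zero) zero (quot k u) (rem k u) (rem k u) q))
      between-different h {u} {v} u<v q = trans
        (runBlocks-⊎ h (Between? u v) suffix? rest? P⇔ suffix<rest q)
        (runBlocks-⊎ h rest? middle? prefix? rest⇔
          (λ x y (_ , x<v) (y≡v , _) → quot-cancel-< k (subst (quot k x <ᶠ_) (sym y≡v) x<v)) _)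
        where
        suffix? = Segment? (suc zero) zero (quot k u) (rem k u) (rem k u)
        prefix? = Segment? zero (suc zero) (quot k v) (rem k v) (rem k v)
        middle? : Decidable (λ y → Between (quot k u) (quot k v) (quot k y))
        middle? y = Between? (quot k u) (quot k v) (quot k y)
        rest? : Decidable (λ y → quot k u <ᶠ quot k y × y <ᶠ v)
        rest? y = (quot k u <ᶠ? quot k y) ×-dec (y <ᶠ? v)
        suffix<rest : ∀ x y → Segment (suc zero) zero (quot k u) (rem k u) (rem k u) x →
                   quot k u <ᶠ quot k y × y <ᶠ v → x <ᶠ y
        suffix<rest x y (x≡u , _) (u<y , _) = quot-cancel-< k (subst (_<ᶠ quot k y) (sym x≡u) u<y)
        P⇔ : ∀ y → Between u v y ⇔ (Segment (suc zero) zero (quot k u) (rem k u) (rem k u) y ⊎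
                                    (quot k u <ᶠ quot k y × y <ᶠ v))
        P⇔ y = mk⇔ split λ
          { (inj₁ (y≡u , u<y , _)) → rem-cancel-< k (sym y≡u) u<y , quot-cancel-< k (subst (_<ᶠ quot k v) (sym y≡u) u<v)
          ; (inj₂ (u<y , y<v)) → quot-cancel-< k u<y , y<v }
          where
          split : Between u v y → _
          split (u<y , y<v) with quot k y ≟ quot k u
          ... | yes y≡u = inj₁ (y≡u , rem-mono-< k (sym y≡u) u<y , tt)
          ... | no  y≢u = inj₂ (≤∧≢⇒< (quot-mono-≤ k {x = u} {y} (<⇒≤ u<y)) (λ eq → y≢u (toℕ-injective (sym eq))) , y<v)
        rest⇔ : ∀ y → (quot k u <ᶠ quot k y × y <ᶠ v) ⇔
                   (Between (quot k u) (quot k v) (quot k y) ⊎ Segment zero (suc zero) (quot k v) (rem k v) (rem k v) y)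
        rest⇔ y = mk⇔ split λ
          { (inj₁ (u<y , y<v)) → u<y , quot-cancel-< k y<v
          ; (inj₂ (y≡v , _ , y<v)) → subst (quot k u <ᶠ_) (sym y≡v) u<v , rem-cancel-< k y≡v y<v }
          where
          split : quot k u <ᶠ quot k y × y <ᶠ v → _
          split (u<y , y<v) with quot k y ≟ quot k v
          ... | yes y≡v = inj₂ (y≡v , tt , rem-mono-< k y≡v y<v)
          ... | no  y≢v = inj₁ (u<y , ≤∧≢⇒< (quot-mono-≤ k {x = y} {v} (<⇒≤ y<v)) (λ eq → y≢v (toℕ-injective eq)))

      -- The closed interval is decomposed around `r`, with nothing above it, and the remainder
      -- around `ℓ`, with nothing below it.
      infix-around : ∀ {ℓ r} → ℓ <ᶠ r → {P : Fin n → Set} (P? : Decidable P) →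
                     (∀ y → P y ⇔ (toℕ ℓ ≤ toℕ y × toℕ y ≤ toℕ r)) → ∀ q →
                     runBlocks 0 P? q ≡ stepMaybe (w r) (runBlocks 0 (Between? ℓ r) (stepMaybe (w ℓ) q))
      infix-around {ℓ} {r} ℓ<r P? P⇔ q = trans
        (runBlocks-around 0 P? below? none? r (from (P⇔ r) (<⇒≤ ℓ<r , ≤-refl))
          (λ y → mk⇔ (λ (ℓ≤y , y<r) → from (P⇔ y) (ℓ≤y , <⇒≤ y<r) , y<r) (λ (p , y<r) → proj₁ (to (P⇔ y) p) , y<r))
          (λ y → mk⇔ (λ ()) (λ (p , r<y) → contradiction r<y (≤⇒≯ (proj₂ (to (P⇔ y) p))))) q)
        (trans (trans (runNone (runBlocks 0 (_≟ r) (runBlocks 0 below? q))) (runBlocks-letter r (runBlocks 0 below? q)))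
          (cong (stepMaybe (w r)) (trans
            (runBlocks-around 0 below? none? (Between? ℓ r) ℓ (≤-refl , ℓ<r)
              (λ y → mk⇔ (λ ()) (λ ((ℓ≤y , _) , y<ℓ) → contradiction y<ℓ (≤⇒≯ ℓ≤y)))
              (λ y → mk⇔ (λ (ℓ<y , y<r) → (<⇒≤ ℓ<y , y<r) , ℓ<y) (λ ((_ , y<r) , ℓ<y) → ℓ<y , y<r)) q)
            (cong (runBlocks 0 (Between? ℓ r))
              (trans (cong (runBlocks 0 (_≟ ℓ)) (runNone q)) (runBlocks-letter ℓ q))))))
        where
        below? : Decidable (λ y → toℕ ℓ ≤ toℕ y × y <ᶠ r)
        below? y = (toℕ ℓ ≤? toℕ y) ×-dec (y <ᶠ? r)
        none? : Decidable {A = Fin n} (λ _ → ⊥)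
        none? _ = no λ ()
        runNone : ∀ q → runBlocks 0 none? q ≡ q
        runNone q = cong (λ xs → run xs q) (filter-none none? {xs = allFin n} (All.tabulate (λ _ ())))

    run-local : ∀ {w w′ : Fin n → Maybe (Fin m)} xs → All (λ x → w x ≡ w′ x) xs → ∀ q → run w xs q ≡ run w′ xs q
    run-local []       []         q = refl
    run-local {w} {w′} (x ∷ xs) (eq ∷ eqs) q = trans (run-∷ w x xs q)
      (trans (run-local xs eqs _) (trans (cong (λ l → run w′ xs (stepMaybe l q)) eq) (sym (run-∷ w′ x xs q))))

    -- If the block of `p` is outside the segment, `p` is not among the positions that are read.
    transition-local : ∀ {w w′ : Fin n → Maybe (Fin m)} {p} → (∀ x → x ≢ p → w x ≡ w′ x) → ∀ h a z {c i j} →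
                       ¬ Segment a z c i j (block k h p) → ∀ q →
                       transition w (suc h) a z c i j q ≡ transition w′ (suc h) a z c i j q
    transition-local w≗w′ h a z {c} {i} {j} ¬p = run-local _
      (All.map (λ {x} s → w≗w′ x (λ { refl → ¬p s })) (All.all-filter (Segment? a z c i j ∘ block k h) (allFin n)))

does-true : ∀ {X : Set} (x? : Dec X) → does x? ≡ true → X
does-true (yes x) _ = x

does-false : ∀ {X : Set} (x? : Dec X) → does x? ≡ false → ¬ X
does-false (no ¬x) _ = ¬x

-- The auxiliary relations and their coding

module Construction {m : ℕ} (A : DFA m) (K : ℕ) where

  open DFA A using (states; step; begin; final)
  open Products A K

  -- part h a z q q′ (c , i , j) states that the word of the segment of the
  -- block c of level h, cut at i if a ≠ 0 and at j if z ≠ 0, takes q to q′.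
  data Name : Set where
    occupied : Name
    part     : (h : ℕ) (a z : Fin 2) (q q′ : Q) → Name

  level : Name → ℕ
  level occupied         = 0
  level (part h _ _ _ _) = h

  -- Truncation makes the coding total on names; it is faithful up to level `suc K`, where there is
  -- a single block.
  clip : ℕ → Fin (suc (suc K))
  clip h = fromℕ< (s≤s (m⊓n≤n h (suc K)))

  toℕ-clip : ∀ {h} → h ≤ suc K → toℕ (clip h) ≡ h
  toℕ-clip {h} h≤ = trans (toℕ-fromℕ< (s≤s (m⊓n≤n h (suc K)))) (m≤n⇒m⊓n≡m h≤)

  abstract
    names : ℕ
    names = suc (suc (suc K) * (2 * (2 * (states * states))))

    encode : Name → Fin names
    encode occupied           = zero
    encode (part h a z q q′)  = suc (combine (clip h) (combine a (combine z (combine q q′))))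

    decode : Fin names → Name
    decode zero    = occupied
    decode (suc x) = decode₁ (remQuot (2 * (2 * (states * states))) x)
      where
      decode₄ : Fin (suc (suc K)) → Fin 2 → Fin 2 → Q × Q → Name
      decode₄ h a z (q , q′) = part (toℕ h) a z q q′
      decode₃ : Fin (suc (suc K)) → Fin 2 → Fin 2 × Fin (states * states) → Name
      decode₃ h a (z , x) = decode₄ h a z (remQuot states x)
      decode₂ : Fin (suc (suc K)) → Fin 2 × Fin (2 * (states * states)) → Name
      decode₂ h (a , x) = decode₃ h a (remQuot (states * states) x)
      decode₁ : Fin (suc (suc K)) × Fin (2 * (2 * (states * states))) → Name
      decode₁ (h , x) = decode₂ h (remQuot (2 * (states * states)) x)

    decode-encode : ∀ s → level s ≤ suc K → decode (encode s) ≡ s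
    decode-encode occupied          _  = refl
    decode-encode (part h a z q q′) h≤ = trans
      (cong (λ (h , x) → let (a , x) = remQuot (2 * (states * states)) x
                             (z , x) = remQuot {2} (states * states) x
                             (q , q′) = remQuot {states} states x
                         in part (toℕ h) a z q q′)
            (remQuot-combine {suc (suc K)} (clip h) (combine a (combine z (combine q q′)))))
      (trans
      (cong (λ (a , x) → let (z , x) = remQuot {2} (states * states) x
                             (q , q′) = remQuot {states} states x
                         in part (toℕ (clip h)) a z q q′)
            (remQuot-combine {2} a (combine z (combine q q′))))
      (trans
      (cong (λ (z , x) → let (q , q′) = remQuot {states} states x
                         in part (toℕ (clip h)) a z q q′)
            (remQuot-combine {2} z (combine q q′)))
      (trans
      (cong (λ (q , q′) → part (toℕ (clip h)) a z q q′) (remQuot-combine q q′))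
      (cong (λ h → part h a z q q′) (toℕ-clip h≤)))))

  -- One relation for each coded name; the two functions are the quotient and the remainder.
  auxSize : Kind → ℕ
  auxSize relation = names
  auxSize function = 2

  auxArity : (k : Kind) → Fin (auxSize k) → ℕ
  auxArity relation _ = 3
  auxArity function _ = 1

  vocabulary : Vocabulary
  vocabulary = record
    { auxSchema = record { size = auxSize ; arity = auxArity }
    ; instances = 0
    ; problem   = λ ()
    }

  -- Quantifier-free conditions

  -- Without quantifiers and getUnique, conditions have work 1 and are legal.
  data Term (v : ℕ) : Set where
    var       : Fin v → Term v
    quotᵗ remᵗ : Term v → Term v

  data Cond (v : ℕ) : Set where
    atom       : Name → Term v → Term v → Term v → Cond v
    _≺_ _≈_    : Term v → Term v → Cond v
    bool       : Bool → Cond v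
    neg        : Cond v → Cond v
    _and_ _or_ : Cond v → Cond v → Cond v

  private
    E : ℕ → Kind → Set
    E = Exp vocabulary ∅

  termExp : ∀ {v} → Term v → E v function
  termExp (var x)   = var x
  termExp (quotᵗ t) = aux zero (termExp t ∷ [])
  termExp (remᵗ t)  = aux (suc zero) (termExp t ∷ [])

  condExp : ∀ {v} → Cond v → E v relation
  condExp (atom s t u w) = aux (encode s) (termExp t ∷ termExp u ∷ termExp w ∷ [])
  -- Negation is sound here because both terms are defined once the quotient and remainder functions
  -- are total.
  condExp (t ≺ u)        = neg (termExp u ≼ termExp t)
  condExp (t ≈ u)        = termExp t ≐ termExp u
  condExp (bool b)       = bool b
  condExp (neg φ)        = neg (condExp φ)
  condExp (φ and ψ)      = condExp φ and condExp ψ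
  condExp (φ or ψ)       = condExp φ or condExp ψ

  module _ {n : ℕ} where

    evalTerm : ∀ {v} → Term v → Tuple n v → Fin n
    evalTerm (var x)   e = lookup e x
    evalTerm (quotᵗ t) e = quot K (evalTerm t e)
    evalTerm (remᵗ t)  e = rem K (evalTerm t e)

    Interpretation : Set
    Interpretation = Name → Fin n → Fin n → Fin n → Bool

    interpretation : Structure (auxSchema vocabulary) n → Interpretation
    interpretation 𝒜 s c i j = 𝒜 relation (encode s) (c ∷ i ∷ j ∷ [])

    evalCond : ∀ {v} → Interpretation → Cond v → Tuple n v → Bool
    evalCond ρ (atom s t u w) e = ρ s (evalTerm t e) (evalTerm u e) (evalTerm w e)
    evalCond ρ (t ≺ u)        e = does (evalTerm t e <ᶠ? evalTerm u e)
    evalCond ρ (t ≈ u)        e = does (evalTerm t e ≟ evalTerm u e)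
    evalCond ρ (bool b)       e = b
    evalCond ρ (neg φ)        e = not (evalCond ρ φ e)
    evalCond ρ (φ and ψ)      e = evalCond ρ φ e ∧ evalCond ρ ψ e
    evalCond ρ (φ or ψ)       e = evalCond ρ φ e ∨ evalCond ρ ψ e

  not-≤ᵇ : ∀ a b → not (b ≤ᵇ a) ≡ (suc a ≤ᵇ b)
  not-≤ᵇ a       zero          = refl
  not-≤ᵇ zero    (suc b)       = refl
  not-≤ᵇ (suc a) (suc zero)    = refl
  not-≤ᵇ (suc a) (suc (suc b)) = not-≤ᵇ a (suc b)

  module _ {n : ℕ} (M : ∀ i → Machine (problem vocabulary i) n) (𝒜 : Structure (auxSchema vocabulary) n)
           (L : Structure ∅ n) (σ : Semantics.Instances M 𝒜) where

    open Semantics M 𝒜 using (eval; evals; Legal; Legals)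

    legal-termExp : ∀ {v} (t : Term v) e → Legal L σ (termExp t) e
    legal-termExp (var x)   e = tt
    legal-termExp (quotᵗ t) e = legal-termExp t e , tt
    legal-termExp (remᵗ t)  e = legal-termExp t e , tt

    legal-condExp : ∀ {v} (φ : Cond v) e → Legal L σ (condExp φ) e
    legal-condExp (atom s t u w) e = legal-termExp t e , legal-termExp u e , legal-termExp w e , tt
    legal-condExp (t ≺ u)        e = legal-termExp u e , legal-termExp t e
    legal-condExp (t ≈ u)        e = legal-termExp t e , legal-termExp u e
    legal-condExp (bool b)       e = tt
    legal-condExp (neg φ)        e = legal-condExp φ e
    legal-condExp (φ and ψ)      e = legal-condExp φ e , legal-condExp ψ e
    legal-condExp (φ or ψ)       e = legal-condExp φ e , legal-condExp ψ e

    module _ (quot≡ : ∀ x → 𝒜 function zero (x ∷ []) ≡ just (quot K x))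
             (rem≡ : ∀ x → 𝒜 function (suc zero) (x ∷ []) ≡ just (rem K x)) where

      eval-termExp : ∀ {v} (t : Term v) e → eval L σ (termExp t) e ≡ just (evalTerm t e)
      eval-termExp (var x)   e = refl
      eval-termExp (quotᵗ t) e rewrite eval-termExp t e = quot≡ _
      eval-termExp (remᵗ t)  e rewrite eval-termExp t e = rem≡ _

      eval-condExp : ∀ {v} (φ : Cond v) e → eval L σ (condExp φ) e ≡ evalCond (interpretation 𝒜) φ e
      eval-condExp (atom s t u w) e
        rewrite eval-termExp t e | eval-termExp u e | eval-termExp w e = refl
      eval-condExp (t ≺ u)   e rewrite eval-termExp t e | eval-termExp u e =
        not-≤ᵇ (toℕ (evalTerm t e)) (toℕ (evalTerm u e))
      eval-condExp (t ≈ u)   e rewrite eval-termExp t e | eval-termExp u e = refl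
      eval-condExp (bool b)  e = refl
      eval-condExp (neg φ)   e = cong not (eval-condExp φ e)
      eval-condExp (φ and ψ) e = cong₂ _∧_ (eval-condExp φ e) (eval-condExp ψ e)
      eval-condExp (φ or ψ)  e = cong₂ _∨_ (eval-condExp φ e) (eval-condExp ψ e)

  module _ (n : ℕ) (C : ∀ i → Cost (problem vocabulary i)) where

    open Work {vocabulary} n C using (work)

    work-termExp : ∀ {v} (t : Term v) → work (termExp t) ≤ 1
    work-termExp (var x)   = ≤-refl
    work-termExp (quotᵗ t) = ⊔-lub ≤-refl (⊔-lub (work-termExp t) z≤n)
    work-termExp (remᵗ t)  = ⊔-lub ≤-refl (⊔-lub (work-termExp t) z≤n)

    -- Work is a maximum and not a sum, so the numbers of states and levels do not enter.
    work-condExp : ∀ {v} (φ : Cond v) → work (condExp φ) ≤ 1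
    work-condExp (atom s t u w) = ⊔-lub ≤-refl
      (⊔-lub (work-termExp t) (⊔-lub (work-termExp u) (⊔-lub (work-termExp w) z≤n)))
    work-condExp (t ≺ u)   = ⊔-lub ≤-refl (⊔-lub (⊔-lub ≤-refl (work-termExp u)) (work-termExp t))
    work-condExp (t ≈ u)   = ⊔-lub (⊔-lub ≤-refl (work-termExp t)) (work-termExp u)
    work-condExp (bool b)  = ≤-refl
    work-condExp (neg φ)   = ⊔-lub ≤-refl (work-condExp φ)
    work-condExp (φ and ψ) = ⊔-lub (⊔-lub ≤-refl (work-condExp φ)) (work-condExp ψ)
    work-condExp (φ or ψ)  = ⊔-lub (⊔-lub ≤-refl (work-condExp φ)) (work-condExp ψ)

  -- Functions of states as matrices of conditions

  ⋁ : ∀ {v l} → (Fin l → Cond v) → Cond v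
  ⋁ {l = zero}  φ = bool false
  ⋁ {l = suc l} φ = φ zero or ⋁ (φ ∘ suc)

  -- Functions of states are described by the conditions that q is mapped to q′.
  Matrix : ℕ → Set
  Matrix v = Q → Q → Cond v

  constant : ∀ {v} → (Q → Q) → Matrix v
  constant f q q′ = bool (does (f q ≟ q′))

  -- The Boolean matrix product, a finite disjunction over the intermediate state instead of a
  -- quantifier. `F` acts first.
  _⊙_ : ∀ {v} → Matrix v → Matrix v → Matrix v
  (F ⊙ G) q q′ = ⋁ λ r → F q r and G r q′

  choose : ∀ {v} → Cond v → Matrix v → Matrix v → Matrix v
  choose φ F G q q′ = (φ and F q q′) or (neg φ and G q q′)

  blockᵗ : ∀ {v} → ℕ → Term v → Term v
  blockᵗ zero    t = t
  blockᵗ (suc h) t = quotᵗ (blockᵗ h t)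

  partᵐ : ∀ {v} → ℕ → Fin 2 → Fin 2 → Term v → Term v → Term v → Matrix v
  partᵐ h a z c i j q q′ = atom (part h a z q q′) c i j

  -- The fillers are remainders because entries are maintained only for endpoints in that range.
  letterᵐ : ∀ {v} → Term v → Matrix v
  letterᵐ t = partᵐ 0 zero zero t (remᵗ t) (remᵗ t)

  within : ∀ {v} → Fin 2 → Term v → Term v → Cond v
  within zero    t u = bool true
  within (suc _) t u = t ≺ u

  -- Setting a letter affects unoccupied positions only. A letter may act as the identity, so its
  -- function does not reveal whether the position is occupied; hence the separate relation.
  changedLetter : ∀ {v} → Fin (suc m) → Term v → Matrix v
  changedLetter zero    p = constant id
  changedLetter (suc σ) p =
    choose (atom occupied p (remᵗ p) (remᵗ p)) (letterᵐ p) (constant (λ q → step q σ))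

  -- The recursion is on the level, a fixed number outside the logic, so it unfolds to a single
  -- quantifier-free condition. Only the innermost letter is new: the parts to the left and right
  -- are read from the old structure.
  changed : ∀ {v} → Fin (suc m) → Term v → ℕ → Matrix v
  surrounded : ∀ {v} → Fin (suc m) → Fin 2 → Fin 2 → Term v → ℕ → Term v → Term v → Matrix v
  changed δ p zero    = changedLetter δ p
  changed δ p (suc h) = surrounded δ zero zero p h (remᵗ (blockᵗ h p)) (remᵗ (blockᵗ h p))
  surrounded δ a z p h i j =
    (partᵐ (suc h) a (suc zero) (blockᵗ (suc h) p) i (remᵗ (blockᵗ h p)) ⊙ changed δ p h) ⊙
    partᵐ (suc h) (suc zero) z (blockᵗ (suc h) p) (remᵗ (blockᵗ h p)) j

  afterChange : Fin (suc m) → Maybe (Fin m) → Maybe (Fin m)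
  afterChange zero    l = nothing
  afterChange (suc σ) l = l <∣> just σ

  sets : Fin (suc m) → Bool
  sets zero    = false
  sets (suc _) = true

  -- Every interval of siblings of the block of `p` is rewritten, so those that miss this block have
  -- to copy their old entry.
  update : ∀ {v} → Fin (suc m) → Name → Term v → Term v → Term v → Cond v
  update δ occupied                p i j = bool (sets δ)
  update δ (part zero a z q q′)    p i j = changedLetter δ p q q′
  update δ (part (suc h) a z q q′) p i j =
    choose (within a i (remᵗ (blockᵗ h p)) and within z (remᵗ (blockᵗ h p)) j)
           (surrounded δ a z p h i j)
           (partᵐ (suc h) a z (blockᵗ (suc h) p) i j) q q′

  -- `f` counts the levels left up to `suc K`. There the two blocks coincide, so for `u` below `v`
  -- the base case is only a default value.
  betweenᵐ : ∀ {v} → ℕ → ℕ → Term v → Term v → Matrix v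
  betweenᵐ zero    h u v = constant id
  betweenᵐ (suc f) h u v = choose (quotᵗ u ≈ quotᵗ v)
    (partᵐ (suc h) (suc zero) (suc zero) (quotᵗ u) (remᵗ u) (remᵗ v))
    ((partᵐ (suc h) (suc zero) zero (quotᵗ u) (remᵗ u) (remᵗ u) ⊙ betweenᵐ f (suc h) (quotᵗ u) (quotᵗ v)) ⊙
     partᵐ (suc h) zero (suc zero) (quotᵗ v) (remᵗ v) (remᵗ v))

  infixᵐ : ∀ {v} → Term v → Term v → Matrix v
  infixᵐ ℓ r = choose (ℓ ≺ r) ((letterᵐ ℓ ⊙ betweenᵐ (suc K) 0 ℓ r) ⊙ letterᵐ r)
                 (choose (ℓ ≈ r) (letterᵐ ℓ) (constant id))

  inRange : ∀ {v} → Term v → Term v → Cond v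
  inRange ℓ r = ⋁ λ q → infixᵐ ℓ r begin q and bool (final q)

  -- Correctness of the conditions

  module _ {n : ℕ} where

    eval-blockᵗ : ∀ {v} h (t : Term v) (e : Tuple n v) → evalTerm (blockᵗ h t) e ≡ block K h (evalTerm t e)
    eval-blockᵗ zero    t e = refl
    eval-blockᵗ (suc h) t e = cong (quot K) (eval-blockᵗ h t e)

    module _ (ρ : Interpretation {n}) where

      -- Each disjunct is guarded by the test for one state, so only that of `a` survives.
      eval-⋁ : ∀ {v l} (φ : Fin l → Cond v) {e} a (b : Fin l → Bool) →
               (∀ r → evalCond ρ (φ r) e ≡ does (a ≟ r) ∧ b r) → evalCond ρ (⋁ φ) e ≡ b a
      eval-⋁ {l = suc l} φ {e} zero    b h =
        trans (cong₂ _∨_ (h zero) (none (φ ∘ suc) (h ∘ suc))) (∨-identityʳ (b zero))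
        where
        none : ∀ {l} (φ : Fin l → Cond _) → (∀ r → evalCond ρ (φ r) e ≡ false) → evalCond ρ (⋁ φ) e ≡ false
        none {zero}  φ h = refl
        none {suc l} φ h = cong₂ _∨_ (h zero) (none (φ ∘ suc) (h ∘ suc))
      eval-⋁ {l = suc l} φ     (suc a) b h = cong₂ _∨_ (h zero) (eval-⋁ (φ ∘ suc) a (b ∘ suc) (h ∘ suc))

      record Computes {v} (e : Tuple n v) (F : Matrix v) (f : Q → Q) : Set where
        constructor computes
        field
          entry : ∀ q q′ → evalCond ρ (F q q′) e ≡ does (f q ≟ q′)

      open Computes public

      module _ {v} {e : Tuple n v} where

        computes-≗ : ∀ {F f g} → (∀ q → f q ≡ g q) → Computes e F f → Computes e F g
        computes-≗ f≗g F = computes λ q q′ → trans (entry F q q′) (cong (λ r → does (r ≟ q′)) (f≗g q))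

        computes-⊙ : ∀ {F G f g} → Computes e F f → Computes e G g → Computes e (F ⊙ G) (g ∘ f)
        computes-⊙ {f = f} {g} F G = computes λ q q′ →
          eval-⋁ _ (f q) (λ r → does (g r ≟ q′)) (λ r → cong₂ _∧_ (entry F q r) (entry G r q′))

        computes-choose : ∀ {φ F G f} → (evalCond ρ φ e ≡ true → Computes e F f) →
                          (evalCond ρ φ e ≡ false → Computes e G f) → Computes e (choose φ F G) f
        computes-choose {φ} {F} {G} {f} F≈ G≈ = computes chosen
          where
          chosen : ∀ q q′ → evalCond ρ (choose φ F G q q′) e ≡ does (f q ≟ q′)
          chosen q q′ with evalCond ρ φ e
          ... | true  = trans (∨-identityʳ _) (entry (F≈ refl) q q′)
          ... | false = entry (G≈ refl) q q′

        computes-constant : ∀ {f g} → (∀ q → f q ≡ g q) → Computes e (constant f) g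
        computes-constant f≗g = computes λ q q′ → cong (λ r → does (r ≟ q′)) (f≗g q)

        eval-within : ∀ a (t u : Term v) → evalCond ρ (within a t u) e ≡ does (Within? a (evalTerm t e) (evalTerm u e))
        eval-within zero    t u = refl
        eval-within (suc _) t u = refl

    meaning : (Fin n → Maybe (Fin m)) → Interpretation
    meaning w occupied          c i j = is-just (w c)
    meaning w (part h a z q q′) c i j = does (transition w h a z c i j q ≟ q′)

    IsRem : Fin n → Set
    IsRem i = toℕ i ≤ root K n

    -- Endpoints above the largest remainder are never read nor updated.
    Maintains : Interpretation → (Fin n → Maybe (Fin m)) → Set
    Maintains ρ w = ∀ s → level s ≤ suc K → ∀ c i j → IsRem i → IsRem j → ρ s c i j ≡ meaning w s c i j

    module _ {ρ : Interpretation} {w : Fin n → Maybe (Fin m)} (ρ≈w : Maintains ρ w) where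

      computes-part : ∀ {v} {e : Tuple n v} h a z c i j → h ≤ suc K →
                      IsRem (evalTerm i e) → IsRem (evalTerm j e) →
                      Computes ρ e (partᵐ h a z c i j)
                                   (transition w h a z (evalTerm c e) (evalTerm i e) (evalTerm j e))
      computes-part h a z c i j h≤ i≤ j≤ = computes λ q q′ → ρ≈w (part h a z q q′) h≤ _ _ _ i≤ j≤

      computes-letter : ∀ {v} {e : Tuple n v} t → Computes ρ e (letterᵐ t) (stepMaybe (w (evalTerm t e)))
      computes-letter {e = e} t = computes-part 0 zero zero t (remᵗ t) (remᵗ t) z≤n (rem≤root K _) (rem≤root K _)

      -- `u` and `t` are tied to the level-h blocks of positions `x` and `y`; exhausted fuel then
      -- means level `suc K`, where `block-top` contradicts their being distinct.
      computes-between : ∀ {v} {e : Tuple n v} f h (u t : Term v) (x y : Fin n) → h + f ≡ suc K →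
                         evalTerm u e ≡ block K h x → evalTerm t e ≡ block K h y → evalTerm u e <ᶠ evalTerm t e →
                         Computes ρ e (betweenᵐ f h u t) (runBlocks w h (Between? (evalTerm u e) (evalTerm t e)))
      computes-between {e = e} zero h u t x y h≡ u≡ t≡ u<t =
        contradiction u<t (<-irrefl (cong toℕ (trans u≡ (trans same (sym t≡)))))
        where
        same : block K h x ≡ block K h y
        same rewrite trans (sym (+-identityʳ h)) h≡ = block-top K x y
      computes-between {e = e} (suc f) h u t x y h≡ u≡ t≡ u<t = computes-choose ρ
        (λ eq → computes-≗ ρ (λ q → sym (between-same w h (same eq) q))
                  (computes-part (suc h) (suc zero) (suc zero) (quotᵗ u) (remᵗ u) (remᵗ t) h< (rem≤root K _) (rem≤root K _)))
        (λ neq → computes-≗ ρ (λ q → sym (between-different w h (less neq) q))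
                  (computes-⊙ ρ (computes-⊙ ρ
                    (computes-part (suc h) (suc zero) zero (quotᵗ u) (remᵗ u) (remᵗ u) h< (rem≤root K _) (rem≤root K _))
                    (computes-between f (suc h) (quotᵗ u) (quotᵗ t) x y (trans (sym (+-suc h f)) h≡)
                       (cong (quot K) u≡) (cong (quot K) t≡) (less neq)))
                    (computes-part (suc h) zero (suc zero) (quotᵗ t) (remᵗ t) (remᵗ t) h< (rem≤root K _) (rem≤root K _))))
        where
        h< : suc h ≤ suc K
        h< = subst (suc h ≤_) h≡ (≤-trans (s≤s (m≤m+n h f)) (≤-reflexive (sym (+-suc h f))))
        quot? : Dec (quot K (evalTerm u e) ≡ quot K (evalTerm t e))
        quot? = quot K (evalTerm u e) ≟ quot K (evalTerm t e)
        same : does quot? ≡ true → quot K (evalTerm u e) ≡ quot K (evalTerm t e)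
        same eq = does-true quot? eq
        less : does quot? ≡ false → quot K (evalTerm u e) <ᶠ quot K (evalTerm t e)
        less neq = Fin.≤∧≢⇒< (quot-mono-≤ K {x = evalTerm u e} {evalTerm t e} (<⇒≤ u<t)) (does-false quot? neq)

      -- The decision procedure for the closed interval is arbitrary, so that the filter in
      -- `infixWord` is an instance.
      computes-infix : ∀ {v} {e : Tuple n v} ℓ r {P : Fin n → Set} (P? : ∀ y → Dec (P y)) →
                       (∀ y → P y ⇔ (toℕ (evalTerm ℓ e) ≤ toℕ y × toℕ y ≤ toℕ (evalTerm r e))) →
                       Computes ρ e (infixᵐ ℓ r) (runBlocks w 0 P?)
      computes-infix {e = e} ℓ r P? P⇔ = computes-choose ρ
        (λ lt → computes-≗ ρ (λ q → sym (infix-around w (less lt) P? P⇔ q))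
          (computes-⊙ ρ (computes-⊙ ρ (computes-letter ℓ)
            (computes-between (suc K) 0 ℓ r (evalTerm ℓ e) (evalTerm r e) refl refl refl (less lt)))
            (computes-letter r)))
        (λ nlt → computes-choose ρ
          (λ eq → computes-≗ ρ (λ q → sym (trans (runBlocks-cong w 0 P? (_≟ evalTerm ℓ e) (single (same eq)) q)
                                                 (runBlocks-letter w _ q)))
                    (computes-letter ℓ))
          (λ neq → computes-constant ρ (λ q → cong (λ xs → run w xs q) (sym (empty nlt neq)))))
        where
        less? : Dec (evalTerm ℓ e <ᶠ evalTerm r e)
        less? = evalTerm ℓ e <ᶠ? evalTerm r e
        same? : Dec (evalTerm ℓ e ≡ evalTerm r e)
        same? = evalTerm ℓ e ≟ evalTerm r e
        less : does less? ≡ true → evalTerm ℓ e <ᶠ evalTerm r e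
        less eq = does-true less? eq
        same : does same? ≡ true → evalTerm ℓ e ≡ evalTerm r e
        same eq = does-true same? eq
        single : evalTerm ℓ e ≡ evalTerm r e → ∀ y → _ ⇔ y ≡ evalTerm ℓ e
        single ℓ≡r y = mk⇔
          (λ p → let ℓ≤y , y≤r = to (P⇔ y) p in
                 toℕ-injective (≤-antisym (subst (λ z → toℕ y ≤ toℕ z) (sym ℓ≡r) y≤r) ℓ≤y))
          (λ { refl → from (P⇔ y) (≤-refl , ≤-reflexive (cong toℕ ℓ≡r)) })
        empty : does less? ≡ false → does same? ≡ false → filter P? (allFin n) ≡ []
        empty nlt neq =
          filter-none P? {xs = allFin n} (All.tabulate (λ {y} _ p → let ℓ≤y , y≤r = Equivalence.to (P⇔ y) p in
            does-false less? nlt (Fin.≤∧≢⇒< (≤-trans ℓ≤y y≤r) (does-false same? neq))))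

      eval-inRange : ∀ {v} {e : Tuple n v} ℓ r {P : Fin n → Set} (P? : ∀ y → Dec (P y)) →
                     (∀ y → P y ⇔ (toℕ (evalTerm ℓ e) ≤ toℕ y × toℕ y ≤ toℕ (evalTerm r e))) →
                     evalCond ρ (inRange ℓ r) e ≡ final (runBlocks w 0 P? begin)
      eval-inRange ℓ r P? P⇔ =
        eval-⋁ ρ _ (runBlocks w 0 P? begin) final (λ q → cong (_∧ final q) (entry (computes-infix ℓ r P? P⇔) begin q))

      module _ {w′ : Fin n → Maybe (Fin m)} {p : Fin n} {δ : Fin (suc m)}
               (changed≡ : w′ p ≡ afterChange δ (w p)) (unchanged : ∀ x → x ≢ p → w x ≡ w′ x) where

        computes-changedLetter : ∀ {v} {e : Tuple n v} t → evalTerm t e ≡ p →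
                                 Computes ρ e (changedLetter δ t) (stepMaybe (w′ p))
        computes-changedLetter {e = e} t refl rewrite changed≡ = letters δ
          where
          letters : ∀ δ → Computes ρ e (changedLetter δ t) (stepMaybe (afterChange δ (w (evalTerm t e))))
          letters zero    = computes λ q q′ → refl
          letters (suc σ) = computes-choose ρ
            (λ occ → computes-≗ ρ (old (trans (sym occupied≡) occ)) (computes-letter t))
            (λ free → computes-constant ρ (λ q → sym (new (trans (sym occupied≡) free) q)))
            where
            occupied≡ : ρ occupied (evalTerm t e) (rem K (evalTerm t e)) (rem K (evalTerm t e)) ≡ is-just (w (evalTerm t e))
            occupied≡ = ρ≈w occupied z≤n _ _ _ (rem≤root K _) (rem≤root K _)
            old : ∀ {l} → is-just l ≡ true → ∀ q → stepMaybe l q ≡ stepMaybe (l <∣> just σ) q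
            old {just _} _ q = refl
            new : ∀ {l} → is-just l ≡ false → ∀ q → stepMaybe (l <∣> just σ) q ≡ step q σ
            new {nothing} _ q = refl

        transition-unchanged : ∀ h a z {c i j} → ¬ Segment a z c i j (block K h p) → ∀ q →
                               transition w (suc h) a z c i j q ≡ transition w′ (suc h) a z c i j q
        transition-unchanged = transition-local {w = w} {w′} unchanged

        -- Strict endpoints keep the changed block out of the part on its left, whose old entry is
        -- therefore still valid.
        below-irrefl : ∀ h a {c i} → ¬ Segment a (suc zero) c i (rem K (block K h p)) (block K h p)
        below-irrefl h a (_ , _ , p<p) = <-irrefl refl p<p

        above-irrefl : ∀ h z {c j} → ¬ Segment (suc zero) z c (rem K (block K h p)) j (block K h p)
        above-irrefl h z (_ , p<p , _) = <-irrefl refl p<p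

        -- Mutual induction on the level: the parts at the sides avoid `p` and keep their value, and
        -- the block in the middle is the induction hypothesis.
        computes-changed : ∀ {v} {e : Tuple n v} t → evalTerm t e ≡ p → ∀ h → h ≤ suc K →
                           Computes ρ e (changed δ t h) (runBlocks w′ h (_≟ block K h p))
        computes-surrounded : ∀ {v} {e : Tuple n v} t i j → evalTerm t e ≡ p → ∀ h a z → suc h ≤ suc K →
                              IsRem (evalTerm i e) → IsRem (evalTerm j e) →
                              Computes ρ e (surrounded δ a z t h i j)
                                (λ q → transition w′ (suc h) (suc zero) z
                                         (block K (suc h) p) (rem K (block K h p)) (evalTerm j e)
                                  (runBlocks w′ h (_≟ block K h p)
                                    (transition w′ (suc h) a (suc zero)
                                       (block K (suc h) p) (evalTerm i e) (rem K (block K h p)) q)))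
        computes-changed t t≡ zero    h≤ = computes-≗ ρ (λ q → sym (runBlocks-letter w′ p q)) (computes-changedLetter t t≡)
        computes-changed {e = e} t t≡ (suc h) h≤ = computes-≗ ρ around
          (computes-surrounded t (remᵗ (blockᵗ h t)) (remᵗ (blockᵗ h t)) t≡ h zero zero h≤ (rem≤root K _) (rem≤root K _))
          where
          r≡ : rem K (evalTerm (blockᵗ h t) e) ≡ rem K (block K h p)
          r≡ = cong (rem K) (trans (eval-blockᵗ h t e) (cong (block K h) t≡))
          composed : Fin n → Q → Q
          composed r q = transition w′ (suc h) (suc zero) zero (block K (suc h) p) (rem K (block K h p)) r
            (runBlocks w′ h (_≟ block K h p)
              (transition w′ (suc h) zero (suc zero) (block K (suc h) p) r (rem K (block K h p)) q))
          around : ∀ q → composed (rem K (evalTerm (blockᵗ h t) e)) q ≡ runBlocks w′ (suc h) (_≟ block K (suc h) p) q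
          around q = trans (cong (λ r → composed r q) r≡) (sym (block-around w′ h (block K h p) q))

        computes-surrounded {e = e} t i j t≡ h a z h≤ i≤ j≤ =
          computes-⊙ ρ (computes-⊙ ρ
            (subst₂ (λ c r → Computes ρ e (partᵐ (suc h) a (suc zero) (blockᵗ (suc h) t) i (remᵗ (blockᵗ h t)))
                               (transition w′ (suc h) a (suc zero) c (evalTerm i e) r)) c≡ r≡
              (computes-≗ ρ (transition-unchanged h a (suc zero)
                (subst (λ r → ¬ Segment a (suc zero) (evalTerm (blockᵗ (suc h) t) e) (evalTerm i e) r (block K h p))
                       (sym r≡) (below-irrefl h a)))
                (computes-part (suc h) a (suc zero) (blockᵗ (suc h) t) i (remᵗ (blockᵗ h t)) h≤ i≤ (rem≤root K _))))
            (computes-changed t t≡ h (≤-trans (n≤1+n h) h≤)))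
            (subst₂ (λ c r → Computes ρ e (partᵐ (suc h) (suc zero) z (blockᵗ (suc h) t) (remᵗ (blockᵗ h t)) j)
                               (transition w′ (suc h) (suc zero) z c r (evalTerm j e))) c≡ r≡
              (computes-≗ ρ (transition-unchanged h (suc zero) z
                (subst (λ r → ¬ Segment (suc zero) z (evalTerm (blockᵗ (suc h) t) e) r (evalTerm j e) (block K h p))
                       (sym r≡) (above-irrefl h z)))
                (computes-part (suc h) (suc zero) z (blockᵗ (suc h) t) (remᵗ (blockᵗ h t)) j h≤ (rem≤root K _) j≤)))
          where
          b≡ : evalTerm (blockᵗ h t) e ≡ block K h p
          b≡ = trans (eval-blockᵗ h t e) (cong (block K h) t≡)
          r≡ : rem K (evalTerm (blockᵗ h t) e) ≡ rem K (block K h p)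
          r≡ = cong (rem K) b≡
          c≡ : quot K (evalTerm (blockᵗ h t) e) ≡ quot K (block K h p)
          c≡ = cong (quot K) b≡

        -- If the block of `p` lies in the interval, `transition-around` applies to the new word;
        -- otherwise the segment avoids `p` and the copied entry is right.
        eval-update : ∀ {v} {e : Tuple n v} s t i j → level s ≤ suc K → evalTerm t e ≡ p →
                      IsRem (evalTerm i e) → IsRem (evalTerm j e) →
                      evalCond ρ (update δ s t i j) e ≡
                      meaning w′ s (block K (level s) p) (evalTerm i e) (evalTerm j e)
        eval-update occupied t i j h≤ t≡ i≤ j≤ rewrite changed≡ = occupied≡ δ (w p)
          where
          occupied≡ : ∀ δ l → sets δ ≡ is-just (afterChange δ l)
          occupied≡ zero    l        = refl
          occupied≡ (suc σ) nothing  = refl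
          occupied≡ (suc σ) (just _) = refl
        eval-update (part zero a z q q′) t i j h≤ t≡ i≤ j≤ = entry (computes-changedLetter t t≡) q q′
        eval-update {e = e} (part (suc h) a z q q′) t i j h≤ t≡ i≤ j≤ = entry chosen q q′
          where
          c r : Term _
          c = blockᵗ (suc h) t
          r = remᵗ (blockᵗ h t)
          test : Cond _
          test = within a i r and within z r j
          b≡ : evalTerm (blockᵗ h t) e ≡ block K h p
          b≡ = trans (eval-blockᵗ h t e) (cong (block K h) t≡)
          Inside : Set
          Inside = Within a (evalTerm i e) (rem K (block K h p)) × Within z (rem K (block K h p)) (evalTerm j e)
          inside? : Dec Inside
          inside? = Within? a _ _ ×-dec Within? z _ _
          test≡ : evalCond ρ test e ≡ does inside?
          test≡ = trans (cong₂ _∧_ (eval-within ρ a i r) (eval-within ρ z r j))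
                    (cong (λ b → does (Within? a (evalTerm i e) (rem K b) ×-dec Within? z (rem K b) (evalTerm j e))) b≡)
          chosen : Computes ρ e _ (transition w′ (suc h) a z (block K (suc h) p) (evalTerm i e) (evalTerm j e))
          chosen = computes-choose ρ {φ = test}
            (λ yes′ → let i<r , r<j = inside (trans (sym test≡) yes′) in
              computes-≗ ρ (λ q → sym (transition-around w′ h a z i<r r<j q)) (computes-surrounded t i j t≡ h a z h≤ i≤ j≤))
            (λ no′ → subst (λ c′ → Computes ρ e (partᵐ (suc h) a z c i j)
                                      (transition w′ (suc h) a z c′ (evalTerm i e) (evalTerm j e)))
                      (cong (quot K) b≡)
                      (computes-≗ ρ (transition-unchanged h a z (λ (_ , s) → outside (trans (sym test≡) no′) s))
                        (computes-part (suc h) a z c i j h≤ i≤ j≤)))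
            where
            inside : does inside? ≡ true → Inside
            inside = does-true inside?
            outside : does inside? ≡ false → ¬ Inside
            outside = does-false inside?

        -- All blocks in a segment of `c` have quotient `c`, so only the parent of the block of `p`
        -- can have a segment containing it.
        meaning-unchanged : ∀ s {c} i j → c ≢ block K (level s) p → meaning w s c i j ≡ meaning w′ s c i j
        meaning-unchanged occupied              i j c≢ = cong is-just (unchanged _ c≢)
        meaning-unchanged (part zero a z q q′)  i j c≢ = cong (λ l → does (stepMaybe l q ≟ q′)) (unchanged _ c≢)
        meaning-unchanged (part (suc h) a z q q′) i j c≢ =
          cong (λ r → does (r ≟ q′)) (transition-unchanged h a z (λ (c≡ , _) → c≢ (sym c≡)) q)

-- Letters of the input before and after a change

head-filterᵇ-cong : ∀ {X : Set} {f g : X → Bool} → (∀ x → f x ≡ g x) → ∀ xs → head (filterᵇ f xs) ≡ head (filterᵇ g xs)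
head-filterᵇ-cong {f = f} {g} f≗g xs = cong head
  (filter-≐ (T? ∘ f) (T? ∘ g) ((λ {x} → subst T (f≗g x)) , (λ {x} → subst T (sym (f≗g x)))) xs)

filterᵇ-allFin-≡ : ∀ {n} (f : Fin n → Bool) x → (∀ y → T (f y) ⇔ y ≡ x) → filterᵇ f (allFin n) ≡ x ∷ []
filterᵇ-allFin-≡ f x = filter-allFin-≡ (T? ∘ f)

module _ {m n : ℕ} (w : Structure (wordSchema {m}) n) (p : Fin n) where

  letter-nothing : letter w p ≡ nothing → ∀ τ → w relation τ (p ∷ []) ≡ false
  letter-nothing eq τ with w relation τ (p ∷ []) in wτ
  ... | false = refl
  ... | true with filterᵇ (λ τ → w relation τ (p ∷ [])) (allFin m)
                | ∈-filter⁺ (T? ∘ λ τ → w relation τ (p ∷ [])) (∈-allFin τ) (subst T (sym wτ) tt)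
  ...   | [] | ()
  letter-nothing () τ | true | _ ∷ _ | _

  letter-reset : letter (reset p w) p ≡ nothing
  letter-reset = cong head (filter-none (T? ∘ λ τ → reset p w relation τ (p ∷ [])) {xs = allFin m}
    (All.tabulate (λ {τ} _ → subst T
      (trans (cong (λ b → w relation τ (p ∷ []) ∧ not b) (dec-true (p ≟ p) refl)) (∧-zeroʳ _)))))

  -- At an occupied position the disjunct added by `set` is false and all relations stay as they
  -- are; at a free one all were false and exactly that of `σ` becomes true.
  letter-set : ∀ σ → letter (set σ p w) p ≡ (letter w p <∣> just σ)
  letter-set σ = cases (letter w p) refl
    where
    cases : ∀ l → letter w p ≡ l → letter (set σ p w) p ≡ (l <∣> just σ)
    cases (just τ) eq = trans (head-filterᵇ-cong same (allFin m)) eq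
      where
      same : ∀ τ → set σ p w relation τ (p ∷ []) ≡ w relation τ (p ∷ [])
      same τ rewrite eq | ∧-zeroʳ (equal p p) | ∧-zeroʳ (equal τ σ) = ∨-identityʳ _
    cases nothing eq = cong head (filterᵇ-allFin-≡ _ σ λ τ → subst (λ b → T b ⇔ τ ≡ σ) (sym (new τ)) (T-does (τ ≟ σ)))
      where
      new : ∀ τ → set σ p w relation τ (p ∷ []) ≡ equal τ σ
      new τ rewrite letter-nothing eq τ | eq | dec-true (p ≟ p) refl = ∧-identityʳ (equal τ σ)

  letter-reset-other : ∀ x → x ≢ p → letter w x ≡ letter (reset p w) x
  letter-reset-other x x≢p = head-filterᵇ-cong
    (λ τ → sym (trans (cong (λ b → w relation τ (x ∷ []) ∧ not b) (dec-false (x ≟ p) x≢p)) (∧-identityʳ _))) (allFin m)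

  letter-set-other : ∀ σ x → x ≢ p → letter w x ≡ letter (set σ p w) x
  letter-set-other σ x x≢p = head-filterᵇ-cong
    (λ τ → sym (trans (cong (λ b → w relation τ (x ∷ []) ∨ (equal τ σ ∧ b ∧ not (is-just (letter w p))))
                            (dec-false (x ≟ p) x≢p))
               (trans (cong (w relation τ (x ∷ []) ∨_) (∧-zeroʳ (equal τ σ))) (∨-identityʳ _)))) (allFin m)

-- The dynamic program

-- The first-order syntax has no truth constants, so an equation between a variable and itself
-- stands in.
boolᶠ : ∀ {τ v} → Bool → FO τ (suc v) relation
boolᶠ true  = var zero ≐ var zero
boolᶠ false = neg (var zero ≐ var zero)

eval-bool : ∀ {τ v n} (𝒜 : Structure τ n) b x (e : Tuple n v) → evalFO 𝒜 (boolᶠ b) (x ∷ e) ≡ b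
eval-bool 𝒜 true  x e = dec-true (x ≟ x) refl
eval-bool 𝒜 false x e = cong not (dec-true (x ≟ x) refl)

module Maintenance {m : ℕ} (L : Language m) (regular : Regular L) (K : ℕ) where

  private
    A : DFA m
    A = proj₁ regular

  open DFA A using (states; step; begin; final)
  open Products A K
  open Construction A K

  -- With ε at all positions, every part induces the identity.
  initialᶠ : Name → FO (wordSchema {m}) 3 relation
  initialᶠ occupied          = boolᶠ false
  initialᶠ (part h a z q q′) = boolᶠ (does (q ≟ q′))

  -- The block is computed from `p`; only the two endpoints range over bounded values. This yields
  -- the quadratic factor in the work.
  relationRule : Fin (suc m) → Name → UpdateRule vocabulary 1 relation 3
  relationRule δ s = record
    { locals  = ∅
    ; ℓ       = 2
    ; bounds  = rootBound K ∷ rootBound K ∷ []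
    ; targets = termExp (blockᵗ (level s) (var (# 0))) ∷ var (# 1) ∷ var (# 2) ∷ []
    ; P₁      = skip
    ; P₂      = return (condExp (update δ s (var (# 0)) (var (# 1)) (var (# 2))))
    }

  -- Every update rule has to name a location: this one rewrites its value.
  functionRule : Fin 2 → UpdateRule vocabulary 1 function 1
  functionRule f = record
    { locals  = ∅
    ; ℓ       = 0
    ; bounds  = []
    ; targets = var zero ∷ []
    ; P₁      = skip
    ; P₂      = return (aux f (var zero ∷ []))
    }

  rules : Rules (RangeMember L) vocabulary
  rules = record
    { initially = initialDefinition
    ; onChange  = updateRule
    ; onQuery   = queryRule
    ; invoker   = λ _ ()
    ; exclusive = λ _ _ _ ()
    }
    where
    initialDefinition : ∀ k (s : Fin (auxSize k)) → Definition wordSchema k (auxArity k s)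
    initialDefinition relation s          = initialᶠ (decode s)
    initialDefinition function zero       = quotᶠ K
    initialDefinition function (suc zero) = remᶠ K
    updateRule : Fin (suc m) → ∀ k (s : Fin (auxSize k)) → UpdateRule vocabulary 1 k (auxArity k s)
    updateRule δ relation s = relationRule δ (decode s)
    updateRule δ function f = functionRule f
    queryRule : ∀ k (q : Symbol (queries (RangeMember L)) k) → QueryRule vocabulary (arity (queries (RangeMember L)) k q) k
    queryRule relation q = record { locals = ∅ ; procedure = return (condExp (inRange (var (# 0)) (var (# 1)))) }
    queryRule function ()

  prog : Program (RangeMember L)
  prog = program vocabulary (λ ()) rules

  -- Several tuples may hit one location, and their results are joined by disjunction, which is
  -- idempotent.
  combine-constant : ∀ {V : Vocabulary} {n} (M : ∀ i → Machine (problem V i) n) 𝒜 {X : Set} (f : X → Bool) xs old v →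
                     (∀ x → x ∈ xs → f x ≡ v) → (xs ≡ [] → old ≡ v) →
                     Semantics.combine {V} M 𝒜 relation old (map f xs) ≡ v
  combine-constant M 𝒜 f []       old v f≡v old≡v = old≡v refl
  combine-constant M 𝒜 f (x ∷ xs) old v f≡v old≡v = or-constant x xs f≡v
    where
    or-constant : ∀ x xs → (∀ y → y ∈ x ∷ xs → f y ≡ v) → Bool.or (map f (x ∷ xs)) ≡ v
    or-constant x []       f≡v = trans (∨-identityʳ _) (f≡v x (here refl))
    or-constant x (y ∷ xs) f≡v = trans
      (cong₂ _∨_ (f≡v x (here refl)) (or-constant y xs (λ z z∈ → f≡v z (there z∈)))) (∨-idem v)

  -- The invariant and its preservation

  module _ {n : ℕ} (M : ∀ i → Machine (problem vocabulary i) n) where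

    record Invariant (w : Structure (wordSchema {m}) n)
                     (st : Structure (auxSchema vocabulary) n × (∀ i → State (M i))) : Set where
      constructor invariant
      field
        quot≡     : ∀ x → proj₁ st function zero (x ∷ []) ≡ just (quot K x)
        rem≡      : ∀ x → proj₁ st function (suc zero) (x ∷ []) ≡ just (rem K x)
        maintains : Maintains (interpretation (proj₁ st)) (letter w)

    open Invariant

    run-empty : ∀ (w : Fin n → Maybe (Fin m)) → (∀ x → w x ≡ nothing) → ∀ xs q → run w xs q ≡ q
    run-empty w none []       q = refl
    run-empty w none (x ∷ xs) q = trans (run-∷ w x xs q)
      (trans (cong (λ l → run w xs (stepMaybe l q)) (none x)) (run-empty w none xs q))

    letter-empty : ∀ x → letter {m} {n} emptyStructure x ≡ nothing
    letter-empty x = cong head (filter-none (T? ∘ λ _ → false) {xs = allFin m} (All.tabulate (λ _ ())))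

    transition-empty : ∀ h a z c i j q → transition (letter {m} {n} emptyStructure) h a z c i j q ≡ q
    transition-empty zero    a z c i j q = cong (λ l → stepMaybe l q) (letter-empty c)
    transition-empty (suc h) a z c i j q = 
      run-empty (letter emptyStructure) letter-empty (filter (Segment? a z c i j ∘ block K h) (allFin n)) q

    eval-initial : ∀ s (c i j : Fin n) →
                   evalFO emptyStructure (initialᶠ s) (c ∷ i ∷ j ∷ []) ≡ meaning (letter emptyStructure) s c i j
    eval-initial occupied          c i j =
      trans (eval-bool {wordSchema {m}} emptyStructure false c (i ∷ j ∷ [])) (sym (cong is-just (letter-empty c)))
    eval-initial (part h a z q q′) c i j = trans (eval-bool {wordSchema {m}} emptyStructure (does (q ≟ q′)) c (i ∷ j ∷ []))
      (sym (cong (λ r → does (r ≟ q′)) (transition-empty h a z c i j q)))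

    initial-invariant : Invariant emptyStructure (start (machine rules M))
    initial-invariant = invariant
      (λ x → cong singleton (filterᵇ-allFin-≡ _ _ (λ y → eval-quot emptyStructure K y x)))
      (λ x → cong singleton (filterᵇ-allFin-≡ _ _ (λ y → eval-rem emptyStructure K y x)))
      λ s s≤ c i j i≤ j≤ → trans (cong (λ s → evalFO emptyStructure (initialᶠ s) (c ∷ i ∷ j ∷ [])) (decode-encode s s≤))
                                 (eval-initial s c i j)

    module _ (𝒜 : Structure (auxSchema vocabulary) n) (σ : ∀ i → State (M i)) where

      open Semantics M 𝒜

      function-unchanged : ∀ f p x → Update.updated (functionRule f) (p ∷ []) σ (𝒜 function f) (x ∷ []) ≡
                           𝒜 function f (x ∷ [])
      function-unchanged f p x with Update.hits (functionRule f) (p ∷ []) σ (x ∷ []) [] in hit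
      ... | false = refl
      ... | true  = cong (𝒜 function f)
        (Maybe.just-injective
          (to (T-does (Maybe.≡-dec (Vec.≡-dec _≟_) (just (p ∷ [])) (just (x ∷ [])))) (subst T (sym hit) tt)))

    module _ {w : Structure (wordSchema {m}) n} {st} (inv : Invariant w st) where

      private
        𝒜 = proj₁ st
        σ = proj₂ st
      open Semantics M 𝒜

      target≡ : ∀ δ s p i j → Update.target (relationRule δ s) (p ∷ []) σ (i ∷ j ∷ []) ≡
                              just (block K (level s) p ∷ i ∷ j ∷ [])
      target≡ δ s p i j = cong (λ x → consMaybe x (just (i ∷ j ∷ [])))
        (trans (eval-termExp M 𝒜 emptyStructure σ (quot≡ inv) (rem≡ inv) (blockᵗ (level s) (var (# 0))) (p ∷ i ∷ j ∷ []))
               (cong just (eval-blockᵗ (level s) (var (# 0)) (p ∷ i ∷ j ∷ []))))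

      ∈-boundedTuples : ∀ {i j : Fin n} → IsRem i → IsRem j →
                         (i ∷ j ∷ []) ∈ boundedTuples n (rootBound K ∷ rootBound K ∷ [])
      ∈-boundedTuples i≤ j≤ = ∈-cartesianProductWith⁺ _∷_ (∈-filter⁺ (λ z → toℕ z ≤? root K n) (∈-allFin _) i≤)
        (∈-cartesianProductWith⁺ _∷_ (∈-filter⁺ (λ z → toℕ z ≤? root K n) (∈-allFin _) j≤) (here refl))

      -- A location is hit only if `c` is the block of `p`, and then every hit returns the new
      -- meaning. A location that is not hit belongs to another block, whose meaning is unchanged.
      relation-updated : ∀ {w′ : Fin n → Maybe (Fin m)} {p δ} → w′ p ≡ afterChange δ (letter w p) →
                         (∀ x → x ≢ p → letter w x ≡ w′ x) →
                         ∀ s → level s ≤ suc K → ∀ c i j → IsRem i → IsRem j →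
                         Update.updated (relationRule δ s) (p ∷ []) σ (𝒜 relation (encode s)) (c ∷ i ∷ j ∷ []) ≡
                         meaning w′ s c i j
      relation-updated {w′} {p} {δ} new same s s≤ c i j i≤ j≤ =
        combine-constant M 𝒜 returned (filterᵇ (hits y) tuples) (𝒜 relation (encode s) y) (meaning w′ s c i j) hit miss
        where
        open Update (relationRule δ s) (p ∷ []) σ
        y : Tuple n 3
        y = c ∷ i ∷ j ∷ []
        tuples : List (Tuple n 2)
        tuples = boundedTuples n (rootBound K ∷ rootBound K ∷ [])
        hits⇔ : ∀ x → T (hits y x) ⇔ target x ≡ just y
        hits⇔ x = T-does (Maybe.≡-dec (Vec.≡-dec _≟_) (target x) (just y))
        hit : ∀ x → x ∈ filterᵇ (hits y) tuples → returned x ≡ meaning w′ s c i j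
        hit (i′ ∷ j′ ∷ []) x∈
          with trans (sym (target≡ δ s p i′ j′)) (to (hits⇔ _) (proj₂ (∈-filter⁻ (T? ∘ hits y) {xs = tuples} x∈)))
        ... | refl = trans (eval-condExp M 𝒜 emptyStructure σ (quot≡ inv) (rem≡ inv)
                             (update δ s (var (# 0)) (var (# 1)) (var (# 2))) _)
                           (eval-update (maintains inv) new same s (var (# 0)) (var (# 1)) (var (# 2)) s≤ refl i≤ j≤)
        miss : filterᵇ (hits y) tuples ≡ [] → 𝒜 relation (encode s) y ≡ meaning w′ s c i j
        miss none = trans (maintains inv s s≤ c i j i≤ j≤)
          -- If `c` were the block of `p`, then the pair of `i` and `j`, which satisfies the bounds,
          -- would be a hit.
          (meaning-unchanged (maintains inv) {δ = δ} new same s i j λ { refl →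
            contradiction (subst ((i ∷ j ∷ []) ∈_) none
              (∈-filter⁺ (T? ∘ hits y) (∈-boundedTuples i≤ j≤) (from (hits⇔ (i ∷ j ∷ [])) (target≡ δ s p i j)))) λ () })

    change-invariant : ∀ w st δ (a : Tuple n 1) → Invariant w st →
                       Invariant (perform (RangeMember L) δ a w) (change (machine rules M) δ a st)
    change-invariant w st@(𝒜 , σ) δ (p ∷ []) inv = invariant
      (λ x → trans (function-unchanged 𝒜 σ zero p x) (quot≡ inv x))
      (λ x → trans (function-unchanged 𝒜 σ (suc zero) p x) (rem≡ inv x))
      λ s s≤ c i j i≤ j≤ → trans
        (cong (λ s′ → Semantics.Update.updated M 𝒜 (relationRule δ s′) (p ∷ []) σ (𝒜 relation (encode s)) (c ∷ i ∷ j ∷ []))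
              (decode-encode s s≤))
        (relation-updated inv (new δ) (same δ) s s≤ c i j i≤ j≤)
      where
      new : ∀ δ → letter (perform (RangeMember L) δ (p ∷ []) w) p ≡ afterChange δ (letter w p)
      new zero    = letter-reset w p
      new (suc τ) = letter-set w p τ
      same : ∀ δ x → x ≢ p → letter w x ≡ letter (perform (RangeMember L) δ (p ∷ []) w) x
      same zero    = letter-reset-other w p
      same (suc τ) = letter-set-other w p τ

    reachable-invariant : ∀ ops → Invariant (inputAfter (RangeMember L) n ops) (stateAfter (machine rules M) ops)
    reachable-invariant = foldl-preserves (λ w st (δ , a) → change-invariant w st δ a) initial-invariant
      where
      foldl-preserves : ∀ {a} {X Y : Set} {O : Set a} {R : X → Y → Set} {f : X → O → X} {g : Y → O → Y} →
                        (∀ x y o → R x y → R (f x o) (g y o)) → ∀ {x y} → R x y → ∀ os → R (foldl f x os) (foldl g y os)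
      foldl-preserves step r []       = r
      foldl-preserves step r (o ∷ os) = foldl-preserves step (step _ _ o r) os

    legal-update : ∀ 𝒜 σ δ (a : Tuple n 1) k (s : Fin (auxSize k)) →
                   Semantics.Update.LegalUpdate M 𝒜 (onChange rules δ k s) a σ
    legal-update 𝒜 σ δ (p ∷ []) relation s =
      tt ,
      (λ { (i ∷ j ∷ []) _ →
             (legal-termExp M 𝒜 emptyStructure σ (blockᵗ (level (decode s)) (var (# 0))) _ , tt , tt , tt) ,
             legal-condExp M 𝒜 emptyStructure σ (update δ (decode s) (var (# 0)) (var (# 1)) (var (# 2))) _ }) ,
      tt
    -- The rule has no bounded variables, so consistency only compares the empty tuple with itself.
    legal-update 𝒜 σ δ (p ∷ []) function f = tt , (λ { [] _ → (tt , tt) , tt , tt }) , λ { [] [] _ _ _ _ _ → refl }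

    answer-correct : ∀ {w st} → Invariant w st → ∀ k q (a : Tuple n (arity (queries (RangeMember L)) k q)) →
                     Semantics.Query.LegalQuery M (proj₁ st) (onQuery rules k q) a (proj₂ st) ×
                     Answers (RangeMember L) w k q a (answer (machine rules M) st k q a)
    answer-correct {w} {𝒜 , σ} inv relation q (ℓ ∷ r ∷ []) =
      legal-condExp M 𝒜 emptyStructure σ (inRange (var (# 0)) (var (# 1))) (ℓ ∷ r ∷ []) ,
      subst (λ b → T b ⇔ L (infixWord w ℓ r))
        (sym (trans (eval-condExp M 𝒜 emptyStructure σ (quot≡ inv) (rem≡ inv) (inRange (var (# 0)) (var (# 1))) (ℓ ∷ r ∷ []))
                    (eval-inRange (maintains inv) (var (# 0)) (var (# 1))
                       (λ y → (toℕ ℓ ≤? toℕ y) ×-dec (toℕ y ≤? toℕ r)) (λ y → mk⇔ id id))))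
        (proj₂ regular (infixWord w ℓ r))
    answer-correct inv function ()

  correct : Correct prog
  correct = (λ ()) , λ n ops →
    (λ δ a k s → legal-update _ _ _ δ a k s) , answer-correct _ (reachable-invariant _ ops)

  -- Work bounds

  module _ (n : ℕ) (C : ∀ i → Cost (problem vocabulary i)) where

    open Work {vocabulary} n C

    workUpdate-≤ : ∀ δ k (s : Fin (auxSize k)) → workUpdate (onChange rules δ k s) ≤ (1 ⊔ root K n) * (1 ⊔ root K n)
    workUpdate-≤ δ relation s = ⊔-lub (1≤ (m≤m⊔n 1 (root K n)))
      (≤-trans (*-monoʳ-≤ (B * (B * 1)) (⊔-lub (work-condExp n C (update δ (decode s) (var (# 0)) (var (# 1)) (var (# 2))))
           (⊔-lub (work-termExp n C (blockᵗ (level (decode s)) (var (# 0)))) (≤-refl {1}))))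
        (≤-reflexive (trans (*-identityʳ (B * (B * 1))) (cong (B *_) (*-identityʳ B)))))
      where
      B : ℕ
      B = 1 ⊔ root K n
      1≤ : 1 ≤ B → 1 ≤ B * B
      1≤ B≥1 = *-mono-≤ B≥1 B≥1
    workUpdate-≤ δ function f = *-mono-≤ (m≤m⊔n 1 (root K n)) (m≤m⊔n 1 (root K n))

    workQuery-≤ : ∀ k q → workQuery (onQuery rules k q) ≤ (1 ⊔ root K n) * (1 ⊔ root K n)
    workQuery-≤ relation q = ≤-trans (work-condExp n C (inRange (var (# 0)) (var (# 1))))
      (*-mono-≤ (m≤m⊔n 1 (root K n)) (m≤m⊔n 1 (root K n)))
    workQuery-≤ function ()

0<numerator : ∀ ε → 0ℚ <ℚ ε → 0 < ∣ ↥ ε ∣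
0<numerator (mkℚ +[1+ _ ] _ _) _ = s≤s z≤n
0<numerator (mkℚ -[1+ _ ] _ _) _ = s≤s z≤n
0<numerator ε@(mkℚ +0 d c) p with positive {ε} p
... | ()

-- Let d be the denominator of ε. The d-th power of the bound is the power 2d = `suc k` of 1 ⊔ root,
-- which is at most n for n ≥ 1; and n ≤ n ^ numerator because the numerator is positive.
root²∈O : ∀ ε → 0ℚ <ℚ ε → ∀ k → suc k ≡ ↧ₙ ε + ↧ₙ ε → ∀ {f} →
          (∀ n → f n ≤ (1 ⊔ root k n) * (1 ⊔ root k n)) → f ∈O[n^ ε ]
root²∈O ε 0<ε k 1+k≡2d {f} f≤ = 1 , 1 , bound
  where
  open ≤-Reasoning
  d : ℕ
  d = ↧ₙ ε
  power≤ : ∀ n → 0 < n → (1 ⊔ root k n) ^ suc k ≤ n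
  power≤ n 0<n with ⊔-sel 1 (root k n)
  -- Here the maximum is 1, and the claim reduces to 1 ≤ n.
  ... | inj₁ eq rewrite eq | ^-zeroˡ (suc k) = 0<n
  ... | inj₂ eq rewrite eq = <⇒≤ (root-< k 0<n)
  bound : ∀ n → 1 ≤ n → f n ^ d ≤ 1 ^ d * n ^ ∣ ↥ ε ∣
  bound n 1≤n = begin
    f n ^ d                                   ≤⟨ ^-monoˡ-≤ d (f≤ n) ⟩
    (B * B) ^ d                               ≡⟨ cong (λ x → (B * x) ^ d) (*-identityʳ B) ⟨
    (B ^ 2) ^ d                               ≡⟨ ^-*-assoc B 2 d ⟩
    B ^ (2 * d)                               ≡⟨ cong (λ x → B ^ (d + x)) (+-identityʳ d) ⟩
    B ^ (d + d)                               ≡⟨ cong (B ^_) 1+k≡2d ⟨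
    B ^ suc k                                 ≤⟨ power≤ n 1≤n ⟩
    n                                         ≡⟨ *-identityʳ n ⟨
    n ^ 1                                     ≤⟨ ^-monoʳ-≤ n {{>-nonZero 1≤n}} (0<numerator ε 0<ε) ⟩
    n ^ ∣ ↥ ε ∣                               ≡⟨ *-identityˡ (n ^ ∣ ↥ ε ∣) ⟨
    1 * n ^ ∣ ↥ ε ∣                           ≡⟨ cong (_* n ^ ∣ ↥ ε ∣) (^-zeroˡ d) ⟨
    1 ^ d * n ^ ∣ ↥ ε ∣                       ∎
    where
    B : ℕ
    B = 1 ⊔ root k n

theorem5p1 : ∀ {m : ℕ} (L : Language m) → Regular L →
    (ε : ℚ) → 0ℚ <ℚ ε →
    MaintainableInDynFOWithWork (RangeMember L) (λ f → f ∈O[n^ ε ])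
theorem5p1 L regular ε 0<ε = prog , correct ,
  (λ δ k s → root²∈O ε 0<ε K refl (λ n → workUpdate-≤ n _ δ k s)) ,
  (λ k q → root²∈O ε 0<ε K refl (λ n → workQuery-≤ n _ k q))
  where
  -- `suc K` is definitionally twice the denominator of ε.
  K : ℕ
  K = ℚ.denominator-1 ε + ↧ₙ ε
  open Maintenance L regular K
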